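{- For any integer $n \geq 3$ and any $d$-degenerate graph $G$, $\mathrm{ch}_\Sigma^e(G \,\Box\, K_n) \leq nd + 3$.
   Context: All graphs are finite, simple and loopless. A graph is $d$-degenerate if every induced subgraph of it has a vertex of degree (in that subgraph) at most $d$. The Cartesian product $G\,\Box\,H$ has vertex set $V(G)\times V(H)$, with $(u,u')$ and $(v,v')$ adjacent if and only if either $u=v$ and $u'v'\in E(H)$, or $u'=v'$ and $uv\in E(G)$. $\mathrm{ch}_\Sigma^e(G)$ is the smallest positive integer $k$ such that for every assignment of a list $L_e$ of $k$ real numbers to each edge $e$ of $G$ there is a choice of weights $w(e)\in L_e$ ($e \in E(G)$) for which $v \mapsto \sum_{e\ni v} w(e)$ is a proper colouring of $V(G)$ (adjacent vertices get different sums). -}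

module Defs where

open import Data.Fin using (Fin; _≟_; remQuot)
import Data.Fin as Fin
import Data.Fin.Properties as Finₚ
open import Data.Fin.Subset using (Subset; Nonempty; _∩_; ∣_∣) renaming (_∈_ to _∈ₛ_)
open import Data.List using (List; allFin; cartesianProduct; filter; foldr; map; mapMaybe)
open import Data.Maybe using (Maybe; just; nothing)
open import Data.Nat using (ℕ; _≤_; _⊔_)
import Data.Nat as ℕ
import Data.Nat.Properties as ℕₚ
open import Data.Product using (∃; ∃-syntax; _×_; _,_; proj₁; proj₂)
open import Data.Rational using (ℚ; 0ℚ; ½) renaming
  (_<_ to _<ℚ_; _≤_ to _≤ℚ_; _+_ to _+ℚ_; _-_ to _-ℚ_; _*_ to _*ℚ_; ∣_∣ to ∣_∣ℚ)
import Data.Rational.Properties as ℚₚ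
open import Data.Rational.Solver using (module +-*-Solver)
open import Data.Sum using (_⊎_; inj₁; inj₂)
open import Data.Vec using (Vec; tabulate)
open import Data.Vec.Membership.Propositional using (_∈_)
open import Data.Vec.Relation.Unary.AllPairs using (AllPairs)
open import Relation.Binary.Definitions using (Decidable; Irreflexive; Symmetric)
open import Relation.Binary.PropositionalEquality
  using (_≡_; _≢_; refl; sym; trans; cong; subst; subst₂)
open import Relation.Nullary using (¬_; Dec; yes; no; does)
open import Relation.Nullary.Decidable using (¬?; _×-dec_; _⊎-dec_)

------------------------------------------------------------------------
-- Real numbers

-- A real number is a Cauchy sequence of rationals with a modulus of
-- convergence.  Two sequences may denote the same real, so _≡_ is not
-- the equality of reals; only their apartness _#_ is used below.

record ℝ : Set where
  constructor mkℝ
  field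
    seq    : ℕ → ℚ
    cauchy : ∀ {ε} → 0ℚ <ℚ ε →
             ∃[ N ] (∀ {m n} → N ≤ m → N ≤ n → ∣ seq m -ℚ seq n ∣ℚ <ℚ ε)

open ℝ public

-- "x and y are different reals".  Constructively this is the positive
-- form of the negation of equality; classically the two coincide.

infix 4 _#_

_#_ : ℝ → ℝ → Set
x # y = ∃[ ε ] ∃[ N ] (0ℚ <ℚ ε × (∀ {n} → N ≤ n → ε ≤ℚ ∣ seq x n -ℚ seq y n ∣ℚ))

0ℝ : ℝ
0ℝ = mkℝ (λ _ → 0ℚ) λ 0<ε → 0 , λ _ _ → 0<ε

infixl 6 _+ℝ_

_+ℝ_ : ℝ → ℝ → ℝ
x +ℝ y = mkℝ (λ n → seq x n +ℚ seq y n) proof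
  where
  open +-*-Solver

  regroup : ∀ a b c d → (a -ℚ c) +ℚ (b -ℚ d) ≡ (a +ℚ b) -ℚ (c +ℚ d)
  regroup = solve 4 (λ a b c d → (a :- c) :+ (b :- d) := (a :+ b) :- (c :+ d)) refl

  halves : ∀ ε → ε *ℚ ½ +ℚ ε *ℚ ½ ≡ ε
  halves ε = trans (sym (ℚₚ.*-distribˡ-+ ε ½ ½)) (ℚₚ.*-identityʳ ε)

  proof : ∀ {ε} → 0ℚ <ℚ ε → ∃[ N ] (∀ {m n} → N ≤ m → N ≤ n →
          ∣ (seq x m +ℚ seq y m) -ℚ (seq x n +ℚ seq y n) ∣ℚ <ℚ ε)
  proof {ε} 0<ε = Nx ⊔ Ny , λ {m} {n} N≤m N≤n →
    subst₂ _<ℚ_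
      (cong ∣_∣ℚ (regroup (seq x m) (seq y m) (seq x n) (seq y n)))
      (halves ε)
      (ℚₚ.≤-<-trans
        (ℚₚ.∣p+q∣≤∣p∣+∣q∣ (seq x m -ℚ seq x n) (seq y m -ℚ seq y n))
        (ℚₚ.+-mono-<
          (proj₂ cx (ℕₚ.m⊔n≤o⇒m≤o Nx Ny N≤m) (ℕₚ.m⊔n≤o⇒m≤o Nx Ny N≤n))
          (proj₂ cy (ℕₚ.m⊔n≤o⇒n≤o Nx Ny N≤m) (ℕₚ.m⊔n≤o⇒n≤o Nx Ny N≤n))))
    where
    0<ε/2 : 0ℚ <ℚ ε *ℚ ½
    0<ε/2 = subst (_<ℚ ε *ℚ ½) (ℚₚ.*-zeroˡ ½) (ℚₚ.*-monoˡ-<-pos ½ 0<ε)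
    cx = cauchy x 0<ε/2
    cy = cauchy y 0<ε/2
    Nx = proj₁ cx
    Ny = proj₁ cy

sumℝ : List ℝ → ℝ
sumℝ = foldr _+ℝ_ 0ℝ

------------------------------------------------------------------------
-- Graphs

record Graph (n : ℕ) : Set₁ where
  field
    Adj    : Fin n → Fin n → Set
    adj?   : Decidable Adj
    symm   : Symmetric Adj
    irrefl : Irreflexive _≡_ Adj

open Graph public

neighbours : ∀ {n} → Graph n → Fin n → Subset n
neighbours G v = tabulate λ u → does (adj? G v u)

-- ∣ S ∩ neighbours G v ∣ is the degree of v in the subgraph induced by S.
-- The induced subgraph on no vertices has to be excluded.

Degenerate : ∀ {n} → ℕ → Graph n → Set
Degenerate d G = ∀ S → Nonempty S → ∃[ v ] (v ∈ₛ S × ∣ S ∩ neighbours G v ∣ ≤ d)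

complete : ∀ n → Graph n
complete n = record
  { Adj    = λ u v → u ≢ v
  ; adj?   = λ u v → ¬? (u ≟ v)
  ; symm   = λ u≢v v≡u → u≢v (sym v≡u)
  ; irrefl = λ u≡v u≢v → u≢v u≡v
  }

-- The vertices of the product are numbered through the bijection
-- remQuot n : Fin (m * n) → Fin m × Fin n (inverse: combine).

infixr 7 _□_

_□_ : ∀ {m n} → Graph m → Graph n → Graph (m ℕ.* n)
_□_ {m} {n} G H = record
  { Adj    = λ x y → R (split x) (split y)
  ; adj?   = λ x y → R? (split x) (split y)
  ; symm   = λ {x} {y} → R-sym (split x) (split y)
  ; irrefl = λ { {x} refl → R-irrefl (split x) }
  }
  where
  split : Fin (m ℕ.* n) → Fin m × Fin n
  split = remQuot {m} n

  R : Fin m × Fin n → Fin m × Fin n → Set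
  R (u , u′) (v , v′) = (u ≡ v × Adj H u′ v′) ⊎ (u′ ≡ v′ × Adj G u v)

  R? : Decidable R
  R? (u , u′) (v , v′) = (u ≟ v ×-dec adj? H u′ v′) ⊎-dec (u′ ≟ v′ ×-dec adj? G u v)

  R-sym : ∀ x y → R x y → R y x
  R-sym _ _ (inj₁ (p , a)) = inj₁ (sym p , symm H a)
  R-sym _ _ (inj₂ (p , a)) = inj₂ (sym p , symm G a)

  R-irrefl : ∀ x → ¬ R x x
  R-irrefl _ (inj₁ (_ , a)) = irrefl H refl a
  R-irrefl _ (inj₂ (_ , a)) = irrefl G refl a

-- The unordered edge uv is represented once, by its endpoints in
-- increasing order; the irrelevant fields make an edge determined by its
-- endpoints.

record Edge {n} (G : Graph n) : Set where
  constructor mkEdge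
  field
    src tgt  : Fin n
    .ordered : src Fin.< tgt
    .joined  : Adj G src tgt

open Edge public

infix 4 _∈ₑ_ _∈ₑ?_

_∈ₑ_ : ∀ {n} {G : Graph n} → Fin n → Edge G → Set
v ∈ₑ e = v ≡ src e ⊎ v ≡ tgt e

_∈ₑ?_ : ∀ {n} {G : Graph n} → Decidable (_∈ₑ_ {n} {G})
v ∈ₑ? e = v ≟ src e ⊎-dec v ≟ tgt e

toEdge : ∀ {n} (G : Graph n) → Fin n × Fin n → Maybe (Edge G)
toEdge G (u , v) with u Finₚ.<? v ×-dec adj? G u v
... | yes (u<v , uv) = just (mkEdge u v u<v uv)
... | no _           = nothing

edges : ∀ {n} (G : Graph n) → List (Edge G)
edges {n} G = mapMaybe (toEdge G) (cartesianProduct (allFin n) (allFin n))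

------------------------------------------------------------------------
-- Sum-colouring edge choosability

vertexSum : ∀ {n} (G : Graph n) → (Edge G → ℝ) → Fin n → ℝ
vertexSum G w v = sumℝ (map w (filter (v ∈ₑ?_) (edges G)))

ProperColouring : ∀ {n} → Graph n → (Fin n → ℝ) → Set
ProperColouring G c = ∀ {u v} → Adj G u v → c u # c v

-- A list of k reals is understood to consist of k different reals.

SumChoosable : ∀ {n} → Graph n → ℕ → Set
SumChoosable G k =
  (L : Edge G → Vec ℝ k) → (∀ e → AllPairs _#_ (L e)) →
  ∃[ w ] ((∀ e → w e ∈ L e) × ProperColouring G (vertexSum G w))

-- ch_Σ^e(G) = k

IsChΣᵉ : ∀ {n} → Graph n → ℕ → Set
IsChΣᵉ G k =
  1 ≤ k × SumChoosable G k × (∀ j → 1 ≤ j → SumChoosable G j → k ≤ j)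

-- ch_Σ^e(G) ≤ m.  Classically the two components are equivalent.
-- Constructively a least k cannot be computed, SumChoosable not being
-- decidable a priori, so the number itself exists only up to ¬¬; the
-- first component keeps the content that does not need excluded middle.

infix 4 chΣᵉ_≤_

chΣᵉ_≤_ : ∀ {n} → Graph n → ℕ → Set
chΣᵉ G ≤ m =
  (∃[ k ] (1 ≤ k × k ≤ m × SumChoosable G k)) ×
  ¬ ¬ (∃[ k ] (IsChΣᵉ G k × k ≤ m))

{-# OPTIONS --safe #-}
module Submission where

-- Only the edges inside the copies of Kₙ are weighted with care.  The copies
-- are treated along a degeneracy order of G, so that a vertex of the current
-- copy has at most d neighbours in earlier copies, whose sums it must avoid.
-- Inside a copy, take the vertex t whose sum is largest when every edge has its
-- (d + 1)-st largest value, give the edges at t these values, except one which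
-- uses its d + 1 largest values to avoid the constraints of t, and forbid the d
-- largest values on the remaining edges: then no vertex can overtake t.  Next do
-- the same from below with the smallest values, and so on alternately; a later
-- vertex ties with t only if all its edges keep the largest permitted value,
-- which the following step, or the triangle left at the end, prevents.  Each
-- step costs d values per list and the triangle 3d + 3, altogether nd + 3.
--
-- Reals are replaced by rational approximations at one late index, at which all
-- lists are separated by a fixed ε and all later changes are negligible.

open import Defs
open import Data.Nat using (ℕ; zero; suc; _≤_; _<_; _+_; _*_; _∸_; _⊔_; z≤n; s≤s)
import Data.Nat.Properties as ℕₚ
open import Data.Bool using (true; false; if_then_else_)
open import Data.Empty using (⊥-elim-irr)
open import Data.Fin using (Fin; zero; suc; _≟_; combine; remQuot)
open import Data.Fin.Subset using (Subset; ⊤; _∩_; _-_; ∣_∣) renaming (_∈_ to _∈ₛ_)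
open import Data.Fin.Subset.Properties
  using (nonempty?; ∈⊤; x∈p∩q⁺; x∈p∩q⁻; x∈p∧x≢y⇒x∈p-y; x∈p⇒∣p-x∣<∣p∣)
import Data.Fin.Properties as Finₚ
open import Data.List
  using (List; []; _∷_; _++_; length; map; concatMap; filter; foldr; tabulate)
import Data.List.Properties as Listₚ
open import Data.List.Membership.Propositional using (_∈_; _∉_)
import Data.List.Membership.DecPropositional as DecMembership
open import Data.List.Membership.Propositional.Properties
  using (∈-filter⁻; ∈-upTo⁻; ∈-allFin; ∈-cartesianProduct⁺; ∈-map⁺; ∈-map⁻; ∈-tabulate⁺; ∈-tabulate⁻;
         ∈-concatMap⁺)
open import Data.List.Relation.Binary.Permutation.Propositional
  using (_↭_; ↭-refl; ↭-prep; ↭-swap; ↭-trans; ↭-sym; ↭⇒↭ₛ)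
open import Data.List.Relation.Binary.Permutation.Propositional.Properties
  using (∈-resp-↭; All-resp-↭; ↭-length)
import Data.List.Relation.Binary.Permutation.Setoid.Properties as Permₛ
open import Data.List.Relation.Unary.All as All using (All; []; _∷_)
import Data.List.Relation.Unary.All.Properties as Allₚ
open import Data.List.Relation.Unary.AllPairs as AllPairs using (AllPairs; []; _∷_; tail)
import Data.List.Relation.Unary.AllPairs.Properties as AllPairsₚ
open import Data.List.Relation.Unary.Any as Any using (here; there)
import Data.List.Relation.Unary.Any.Properties as Anyₚ
import Data.Maybe.Relation.Unary.Any as Maybe
open import Data.Product using (∃-syntax; _×_; _,_; proj₁; proj₂)
open import Data.Rational using (ℚ; 0ℚ; 1ℚ; ½) renaming
  (_<_ to _<ℚ_; _≤_ to _≤ℚ_; _+_ to _+ℚ_; _-_ to _-ℚ_; _*_ to _*ℚ_; -_ to -ℚ_; ∣_∣ to ∣_∣ℚ)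
import Data.Rational.Properties as ℚₚ
open import Data.Rational.Solver using (module +-*-Solver)
open import Data.Sum using (_⊎_; inj₁; inj₂; [_,_]′)
import Data.Sum as Sum
open import Data.Vec using (Vec; []; _∷_; toList) renaming (here to hereᵥ; there to thereᵥ)
open import Data.Vec.Membership.Propositional using () renaming (_∈_ to _∈ᵥ_)
open import Data.Vec.Membership.Propositional.Properties using (∈-toList⁻)
import Data.Vec.Properties as Vecₚ
import Data.Vec.Relation.Unary.All as Vecᴬ
import Data.Vec.Relation.Unary.AllPairs as Vecᴾ
open import Function using (_∘_; id)
open import Relation.Binary.Definitions using (tri<; tri≈; tri>)
open import Relation.Binary.PropositionalEquality
  using (_≡_; _≢_; refl; sym; trans; cong; cong₂; subst; subst₂; setoid; resp₂)
open import Relation.Nullary using (¬_; Dec; yes; no; does; contradiction)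
import Relation.Nullary.Decidable as Dec
open import Relation.Nullary.Decidable using (_×-dec_; dec-true; dec-false)

-- Reduces a linear inequality to a sum of hypotheses and a ring identity.
≤-by : ∀ {p q x y} → p ≤ℚ q → y -ℚ x ≡ q -ℚ p → x ≤ℚ y
≤-by {p} {q} {x} {y} p≤q eq = subst₂ _≤ℚ_
  (solve 2 (λ p x → p :+ (x :- p) := x) refl p x)
  (trans (solve 3 (λ p q x → q :+ (x :- p) := (q :- p) :+ x) refl p q x)
    (trans (cong (_+ℚ x) (sym eq)) (solve 2 (λ x y → (y :- x) :+ x := y) refl x y)))
  (ℚₚ.+-monoˡ-≤ (x -ℚ p) p≤q)
  where open +-*-Solver

neg-involutive : ∀ p → -ℚ (-ℚ p) ≡ p
neg-involutive = solve 1 (λ p → :- (:- p) := p) refl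
  where open +-*-Solver

p≤∣p∣ : ∀ p → p ≤ℚ ∣ p ∣ℚ
p≤∣p∣ p with ℚₚ.≤-total 0ℚ p
... | inj₁ 0≤p = ℚₚ.≤-reflexive (sym (ℚₚ.0≤p⇒∣p∣≡p 0≤p))
... | inj₂ p≤0 = ℚₚ.≤-trans p≤0 (ℚₚ.0≤∣p∣ p)

-p≤∣p∣ : ∀ p → -ℚ p ≤ℚ ∣ p ∣ℚ
-p≤∣p∣ p = subst (-ℚ p ≤ℚ_) (ℚₚ.∣-p∣≡∣p∣ p) (p≤∣p∣ (-ℚ p))

-- Finite sums of rationals.

module _ {A : Set} where

  total : List A → (A → ℚ) → ℚ
  total xs f = foldr (λ x s → f x +ℚ s) 0ℚ xs

  total-cong : ∀ xs {f g : A → ℚ} → (∀ x → f x ≡ g x) → total xs f ≡ total xs g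
  total-cong []       f≗g = refl
  total-cong (x ∷ xs) f≗g = cong₂ _+ℚ_ (f≗g x) (total-cong xs f≗g)

  total-neg : ∀ xs (f : A → ℚ) → total xs (λ x → -ℚ f x) ≡ -ℚ total xs f
  total-neg []       f = refl
  total-neg (x ∷ xs) f =
    trans (cong (-ℚ f x +ℚ_) (total-neg xs f)) (sym (ℚₚ.neg-distrib-+ (f x) (total xs f)))

  total-minus : ∀ xs (f g : A → ℚ) → total xs (λ x → f x -ℚ g x) ≡ total xs f -ℚ total xs g
  total-minus []       f g = refl
  total-minus (x ∷ xs) f g = trans (cong ((f x -ℚ g x) +ℚ_) (total-minus xs f g))
    (solve 4 (λ a b c d → (a :- b) :+ (c :- d) := (a :+ c) :- (b :+ d)) refl
      (f x) (g x) (total xs f) (total xs g))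
    where open +-*-Solver

  total-mono : ∀ xs {f g : A → ℚ} → (∀ x → f x ≤ℚ g x) → total xs f ≤ℚ total xs g
  total-mono []       f≤g = ℚₚ.≤-refl
  total-mono (x ∷ xs) f≤g = ℚₚ.+-mono-≤ (f≤g x) (total-mono xs f≤g)

  total-gain : ∀ {xs} {f g : A → ℚ} {x c} → (∀ x → f x ≤ℚ g x) →
               x ∈ xs → f x +ℚ c ≤ℚ g x → total xs f +ℚ c ≤ℚ total xs g
  total-gain {x ∷ xs} {f} {g} {c = c} f≤g (here refl) fx≤gx =
    ≤-by (ℚₚ.+-mono-≤ fx≤gx (total-mono xs f≤g))
      (solve 5 (λ a b c s t → (b :+ t) :- ((a :+ s) :+ c) := (b :+ t) :- ((a :+ c) :+ s)) refl
        (f x) (g x) c (total xs f) (total xs g))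
    where open +-*-Solver
  total-gain {y ∷ xs} {f} {g} {c = c} f≤g (there x∈xs) fx≤gx =
    ≤-by (ℚₚ.+-mono-≤ (f≤g y) (total-gain {xs} {f} {g} f≤g x∈xs fx≤gx))
      (solve 5 (λ a b c s t → (b :+ t) :- ((a :+ s) :+ c) := (b :+ t) :- (a :+ (s :+ c))) refl
        (f y) (g y) c (total xs f) (total xs g))
    where open +-*-Solver

  extract-max : (f : A → ℚ) → ∀ x xs →
                ∃[ y ] ∃[ ys ] ((x ∷ xs) ↭ (y ∷ ys) × All (λ z → f z ≤ℚ f y) ys)
  extract-max f x []       = x , [] , ↭-refl , []
  extract-max f x (z ∷ xs) with extract-max f z xs
  ... | y , ys , p , ys≤y with ℚₚ.≤-total (f x) (f y)
  ...   | inj₁ x≤y = y , x ∷ ys , ↭-trans (↭-prep x p) (↭-swap x y ↭-refl) , x≤y ∷ ys≤y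
  ...   | inj₂ y≤x = x , y ∷ ys , ↭-prep x p , y≤x ∷ All.map (λ z≤y → ℚₚ.≤-trans z≤y y≤x) ys≤y

-- Selection under constraints.

module _ {A C : Set} {R : A → A → Set} {Good : C → A → Set} (good? : ∀ c x → Dec (Good c x)) where

  -- Two related candidates are never both bad, so once a bad one is met all later candidates are
  -- good and the filter keeps them.
  filter-drops-one : ∀ c {xs} → (∀ {x y} → R x y → Good c x ⊎ Good c y) → AllPairs R xs →
                     length xs ≤ suc (length (filter (good? c) xs))
  filter-drops-one c or []                       = z≤n
  filter-drops-one c or (_∷_ {x} {xs} x~xs pairs) with good? c x
  ... | yes g = s≤s (filter-drops-one c or pairs)
  ... | no ¬g = s≤s (ℕₚ.≤-reflexive (cong length (sym (Listₚ.filter-all (good? c)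
                  (All.map (λ x~y → [ (λ g → contradiction g ¬g) , id ]′ (or x~y)) x~xs)))))

  -- Each constraint excludes at most one of the candidates.
  choose : ∀ cs {xs} → All (λ c → ∀ {x y} → R x y → Good c x ⊎ Good c y) cs → AllPairs R xs →
           length cs < length xs → ∃[ x ] (x ∈ xs × All (λ c → Good c x) cs)
  choose []       {x ∷ xs} _          _     _  = x , here refl , []
  choose (c ∷ cs) {xs}     (or ∷ ors) pairs lt
    with x , x∈ , good ← choose cs ors (AllPairsₚ.filter⁺ (good? c) pairs)
           (ℕₚ.≤-pred (ℕₚ.≤-trans lt (filter-drops-one c or pairs)))
    with x∈xs , g ← ∈-filter⁻ (good? c) {xs = xs} x∈ = x , x∈xs , g ∷ good

-- Edges and their endpoints.

module _ {M} {Γ : Graph M} where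

  infix 4 _≟ₑ_

  _≟ₑ_ : (e f : Edge Γ) → Dec (e ≡ f)
  mkEdge a b _ _ ≟ₑ mkEdge c d _ _ with a ≟ c | b ≟ d
  ... | yes refl | yes refl = yes refl
  ... | no a≢c   | _        = no λ { refl → a≢c refl }
  ... | yes _    | no b≢d   = no λ { refl → b≢d refl }

  ∈-edges : (e : Edge Γ) → e ∈ edges Γ
  ∈-edges e@(mkEdge a b a<b ab) = Anyₚ.mapMaybe⁺ (toEdge Γ) _ (Anyₚ.map⁺
    (Any.map (λ { refl → found }) (∈-cartesianProduct⁺ (∈-allFin a) (∈-allFin b))))
    where
    found : Maybe.Any (e ≡_) (toEdge Γ (a , b))
    found with a Finₚ.<? b ×-dec adj? Γ a b
    ... | yes _ = Maybe.just refl
    -- The order and adjacency proofs are irrelevant fields, so they can refute `¬p` only in an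
    -- irrelevant position.
    ... | no ¬p = ⊥-elim-irr (¬p (a<b , ab))

  Adj⇒≢ : ∀ {x y} → Adj Γ x y → x ≢ y
  Adj⇒≢ xy refl = irrefl Γ refl xy

  Joins : Edge Γ → Fin M → Fin M → Set
  Joins e x y = x ∈ₑ e × y ∈ₑ e × (∀ {z} → z ∈ₑ e → z ≡ x ⊎ z ≡ y)

  join : ∀ {x y} → Adj Γ x y → ∃[ e ] Joins e x y
  join {x} {y} xy with Finₚ.<-cmp x y
  ... | tri< x<y _ _ = mkEdge x y x<y xy , inj₁ refl , inj₂ refl , id
  ... | tri≈ _ x≡y _ = contradiction x≡y (Adj⇒≢ xy)
  ... | tri> _ _ y<x = mkEdge y x y<x (symm Γ xy) , inj₂ refl , inj₁ refl , Sum.swap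

  Joins-∉ : ∀ e {x y z} → Joins e x y → z ≢ x → z ≢ y → ¬ z ∈ₑ e
  Joins-∉ e (_ , _ , ends) z≢x z≢y z∈e = [ z≢x , z≢y ]′ (ends z∈e)

-- Colouring a clique with rational weights

module _ {M} {Γ : Graph M} (η : ℚ) (0≤η : 0ℚ ≤ℚ η) where

  private
    V = Fin M
    Weighting = Edge Γ → ℚ

  open DecMembership (_≟_ {M}) using (_∈?_)

  infix 4 _⊏_

  -- The gap is twice `η` because two numbers that far apart cannot both have absolute value below
  -- `η`. Among values separated in this way, each constraint therefore rules out at most one.
  _⊏_ : ℚ → ℚ → Set
  p ⊏ q = p +ℚ (η +ℚ η) ≤ℚ q

  ⊏⇒≤ : ∀ {p q} → p ⊏ q → p ≤ℚ q
  ⊏⇒≤ {p} {q} p⊏q = ≤-by (ℚₚ.+-mono-≤ p⊏q (ℚₚ.+-mono-≤ 0≤η 0≤η))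
    (solve 3 (λ p q n → q :- p := (q :+ (n :+ n)) :- ((p :+ (n :+ n)) :+ (con 0ℚ :+ con 0ℚ))) refl p q η)
    where open +-*-Solver

  ⊏-neg : ∀ {p q} → p ⊏ q → -ℚ q ⊏ -ℚ p
  ⊏-neg {p} {q} p⊏q = ≤-by p⊏q
    (solve 3 (λ p q n → (:- p) :- ((:- q) :+ n) := q :- (p :+ n)) refl p q (η +ℚ η))
    where open +-*-Solver

  ⊏⇒far : ∀ {p q} → p ⊏ q → η ≤ℚ ∣ p ∣ℚ ⊎ η ≤ℚ ∣ q ∣ℚ
  ⊏⇒far {p} {q} p⊏q with ℚₚ.≤-total η ∣ p ∣ℚ
  ... | inj₁ η≤p = inj₁ η≤p
  ... | inj₂ p≤η = inj₂ (ℚₚ.≤-trans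
    (≤-by (ℚₚ.+-mono-≤ p⊏q (ℚₚ.≤-trans (-p≤∣p∣ p) p≤η))
      (solve 3 (λ p q n → q :- n := (q :+ n) :- ((p :+ (n :+ n)) :+ (:- p))) refl p q η))
    (p≤∣p∣ q))
    where open +-*-Solver

  0≤⊏⇒far : ∀ {p q} → 0ℚ ≤ℚ p → p ⊏ q → η ≤ℚ ∣ q ∣ℚ
  0≤⊏⇒far {p} {q} 0≤p p⊏q = ℚₚ.≤-trans
    (≤-by (ℚₚ.+-mono-≤ p⊏q (ℚₚ.+-mono-≤ 0≤p 0≤η))
      (solve 3 (λ p q n → q :- n := (q :+ (p :+ n)) :- ((p :+ (n :+ n)) :+ (con 0ℚ :+ con 0ℚ))) refl p q η))
    (p≤∣p∣ q)
    where open +-*-Solver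

  -- Sums at vertices and their differences.

  share : V → Weighting → Edge Γ → ℚ
  share x w e = if does (x ∈ₑ? e) then w e else 0ℚ

  share-∈ : ∀ {x e} w → x ∈ₑ e → share x w e ≡ w e
  share-∈ {x} {e} w x∈e = cong (if_then w e else 0ℚ) (dec-true (x ∈ₑ? e) x∈e)

  share-∉ : ∀ {x e} w → ¬ x ∈ₑ e → share x w e ≡ 0ℚ
  share-∉ {x} {e} w x∉e = cong (if_then w e else 0ℚ) (dec-false (x ∈ₑ? e) x∉e)

  share-neg : ∀ x w e → share x (λ e → -ℚ w e) e ≡ -ℚ share x w e
  share-neg x w e with does (x ∈ₑ? e)
  ... | true  = refl
  ... | false = refl

  weight : Weighting → V → ℚ
  weight w x = total (edges Γ) (share x w)

  weight-cong : ∀ {w w′} x → (∀ e → w e ≡ w′ e) → weight w x ≡ weight w′ x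
  weight-cong x w≗w′ = total-cong (edges Γ) λ e → cong (if does (x ∈ₑ? e) then_else 0ℚ) (w≗w′ e)

  -- The difference of two vertex sums is taken edge by edge over all edges of `Γ`. An edge meeting
  -- both vertices or neither contributes 0, and monotonicity can be checked on single edges.
  δ : V → V → Weighting → Edge Γ → ℚ
  δ x y w e = share x w e -ℚ share y w e

  D : V → V → Weighting → ℚ
  D x y w = total (edges Γ) (δ x y w)

  D-weight : ∀ x y w → D x y w ≡ weight w x -ℚ weight w y
  D-weight x y w = total-minus (edges Γ) (share x w) (share y w)

  0≤D : ∀ x y w → weight w y ≤ℚ weight w x → 0ℚ ≤ℚ D x y w
  0≤D x y w y≤x = subst (0ℚ ≤ℚ_) (sym (D-weight x y w))
    (≤-by y≤x (ℚₚ.+-identityʳ (weight w x -ℚ weight w y)))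

  δ-∈∉ : ∀ {x y e} w → x ∈ₑ e → ¬ y ∈ₑ e → δ x y w e ≡ w e
  δ-∈∉ {e = e} w x∈e y∉e = trans (cong₂ _-ℚ_ (share-∈ w x∈e) (share-∉ w y∉e)) (ℚₚ.+-identityʳ (w e))

  δ-∉∈ : ∀ {x y e} w → ¬ x ∈ₑ e → y ∈ₑ e → δ x y w e ≡ -ℚ w e
  δ-∉∈ {e = e} w x∉e y∈e = trans (cong₂ _-ℚ_ (share-∉ w x∉e) (share-∈ w y∈e)) (ℚₚ.+-identityˡ (-ℚ w e))

  δ-∉∉ : ∀ {x y e} w → ¬ x ∈ₑ e → ¬ y ∈ₑ e → δ x y w e ≡ 0ℚ
  δ-∉∉ w x∉e y∉e = cong₂ _-ℚ_ (share-∉ w x∉e) (share-∉ w y∉e)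

  δ-∈∈ : ∀ {x y e} w → x ∈ₑ e → y ∈ₑ e → δ x y w e ≡ 0ℚ
  δ-∈∈ {e = e} w x∈e y∈e = trans (cong₂ _-ℚ_ (share-∈ w x∈e) (share-∈ w y∈e)) (ℚₚ.+-inverseʳ (w e))

  δ-≤ : ∀ x y {w w′ e} → (x ∈ₑ e → ¬ y ∈ₑ e → w e ≤ℚ w′ e) → (¬ x ∈ₑ e → y ∈ₑ e → w′ e ≤ℚ w e) →
        δ x y w e ≤ℚ δ x y w′ e
  δ-≤ x y {w} {w′} {e} up down with x ∈ₑ? e | y ∈ₑ? e
  ... | yes p | yes q = ℚₚ.≤-reflexive (trans (δ-∈∈ w p q) (sym (δ-∈∈ w′ p q)))
  ... | yes p | no ¬q = subst₂ _≤ℚ_ (sym (δ-∈∉ w p ¬q)) (sym (δ-∈∉ w′ p ¬q)) (up p ¬q)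
  ... | no ¬p | yes q =
    subst₂ _≤ℚ_ (sym (δ-∉∈ w ¬p q)) (sym (δ-∉∈ w′ ¬p q)) (ℚₚ.neg-antimono-≤ (down ¬p q))
  ... | no ¬p | no ¬q = ℚₚ.≤-reflexive (trans (δ-∉∉ w ¬p ¬q) (sym (δ-∉∉ w′ ¬p ¬q)))

  D-gain : ∀ x y w w′ {e} → (∀ e → δ x y w e ≤ℚ δ x y w′ e) → δ x y w e ⊏ δ x y w′ e →
           D x y w ⊏ D x y w′
  D-gain x y w w′ {e} δ≤ δ⊏ = total-gain δ≤ (∈-edges e) δ⊏

  -- A record and not a synonym, so that unification recovers `w`, `x` and `y` from the type.
  record Far (w : Weighting) (x y : V) : Set where
    constructor far
    field gap : η ≤ℚ ∣ D x y w ∣ℚ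

  open Far public

  far? : ∀ w x y → Dec (Far w x y)
  far? w x y = Dec.map′ far gap (η ℚₚ.≤? ∣ D x y w ∣ℚ)

  far-sym : ∀ {w x y} → Far w x y → Far w y x
  far-sym {w} {x} {y} = far ∘ subst (η ≤ℚ_) (trans (sym (ℚₚ.∣-p∣≡∣p∣ (D x y w))) (cong ∣_∣ℚ
    (trans (cong -ℚ_ (D-weight x y w)) (trans
      (solve 2 (λ a b → :- (a :- b) := b :- a) refl (weight w x) (weight w y))
      (sym (D-weight y x w)))))) ∘ gap
    where open +-*-Solver

  -- Separation is insensitive to sign; this allows the same step to work alternately from above and
  -- from below.
  far-neg : ∀ {w x y} → Far w x y → Far (λ e → -ℚ w e) x y
  far-neg {w} {x} {y} = far ∘ subst (η ≤ℚ_) (sym (trans (cong ∣_∣ℚ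
    (trans (total-cong (edges Γ) neg) (total-neg (edges Γ) (δ x y w)))) (ℚₚ.∣-p∣≡∣p∣ (D x y w)))) ∘ gap
    where
    neg : ∀ e → δ x y (λ e → -ℚ w e) e ≡ -ℚ δ x y w e
    neg e = trans (cong₂ _-ℚ_ (share-neg x w e) (share-neg y w e))
                  (sym (ℚₚ.neg-distrib-+ (share x w e) (-ℚ share y w e)))

  -- Edges meeting neither or both of `x` and `y` cancel in `D x y`, so their weights may change
  -- freely. This is how separations survive all later choices.
  far-cong : ∀ {w w′ x y} →
             (∀ e → w e ≡ w′ e ⊎ (¬ x ∈ₑ e × ¬ y ∈ₑ e) ⊎ (x ∈ₑ e × y ∈ₑ e)) →
             Far w x y → Far w′ x y
  far-cong {w} {w′} {x} {y} same = far ∘ subst (η ≤ℚ_) (cong ∣_∣ℚ (total-cong (edges Γ) eq)) ∘ gap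
    where
    eq : ∀ e → δ x y w e ≡ δ x y w′ e
    eq e with same e
    ... | inj₁ w≡w′ rewrite w≡w′       = refl
    ... | inj₂ (inj₁ (x∉e , y∉e)) = trans (δ-∉∉ w x∉e y∉e) (sym (δ-∉∉ w′ x∉e y∉e))
    ... | inj₂ (inj₂ (x∈e , y∈e)) = trans (δ-∈∈ w x∈e y∈e) (sym (δ-∈∈ w′ x∈e y∈e))

  set : Weighting → Edge Γ → ℚ → Weighting
  set w e q f = if does (f ≟ₑ e) then q else w f

  set-≡ : ∀ w e q → set w e q e ≡ q
  set-≡ w e q = cong (if_then q else w e) (dec-true (e ≟ₑ e) refl)

  set-≢ : ∀ w e f q → f ≢ e → set w e q f ≡ w f
  set-≢ w e f q f≢e = cong (if_then q else w f) (dec-false (f ≟ₑ e) f≢e)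

  far-set : ∀ {w} e q {x y} → (¬ x ∈ₑ e × ¬ y ∈ₑ e) ⊎ (x ∈ₑ e × y ∈ₑ e) →
            Far w x y → Far (set w e q) x y
  far-set {w} e q {x} {y} out = far-cong same
    where
    same : ∀ f → w f ≡ set w e q f ⊎ (¬ x ∈ₑ f × ¬ y ∈ₑ f) ⊎ (x ∈ₑ f × y ∈ₑ f)
    same f with f ≟ₑ e
    ... | yes refl = inj₂ out
    ... | no _     = inj₁ refl

  D-set : ∀ w {x y e p q} → x ∈ₑ e → ¬ y ∈ₑ e → p ⊏ q → D x y (set w e p) ⊏ D x y (set w e q)
  D-set w {x} {y} {e} {p} {q} x∈e y∉e p⊏q = D-gain x y (set w e p) (set w e q)
    (λ f → δ-≤ x y {set w e p} {set w e q} (λ _ _ → mono f) (λ x∉f y∈f → ℚₚ.≤-reflexive (other f x∉f)))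
    (subst₂ _⊏_ (sym (at p)) (sym (at q)) p⊏q)
    where
    at : ∀ r → δ x y (set w e r) e ≡ r
    at r = trans (δ-∈∉ (set w e r) x∈e y∉e) (set-≡ w e r)

    mono : ∀ f → set w e p f ≤ℚ set w e q f
    mono f with f ≟ₑ e
    ... | yes refl = ⊏⇒≤ p⊏q
    ... | no _     = ℚₚ.≤-refl

    other : ∀ f → ¬ x ∈ₑ f → set w e q f ≡ set w e p f
    other f x∉f with f ≟ₑ e
    ... | yes refl = contradiction x∈e x∉f
    ... | no _     = refl

  -- A list is a function on `ℕ` read below `k`, so that dropping the largest values and reversing
  -- the rest become arithmetic on indices.
  Decreasing : ℕ → (ℕ → ℚ) → Set
  Decreasing k a = ∀ {i j} → i < j → j < k → a j ⊏ a i

  -- As i varies, D x y changes by at least the gap of a if e meets x but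
  -- not y, so each pair rules out at most one i.
  choose-weight : ∀ {k a} → Decreasing k a → ∀ w e cs →
    All (λ c → proj₁ c ∈ₑ e × ¬ proj₂ c ∈ₑ e) cs → length cs < k →
    ∃[ i ] (i < k × All (λ c → Far (set w e (a i)) (proj₁ c) (proj₂ c)) cs)
  choose-weight {k} {a} dec w e cs separating lt
    with i , i∈ , good ← choose {R = λ i j → a j ⊏ a i}
           {Good = λ c i → Far (set w e (a i)) (proj₁ c) (proj₂ c)}
           (λ c i → far? (set w e (a i)) (proj₁ c) (proj₂ c)) cs
           (All.map (λ { (x∈e , y∉e) j⊏i → Sum.swap (Sum.map far far (⊏⇒far (D-set w x∈e y∉e j⊏i))) }) separating)
           (AllPairsₚ.applyUpTo⁺₁ id k dec)
           (subst (length cs <_) (sym (Listₚ.length-upTo k)) lt)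
    = i , ∈-upTo⁻ i∈ , good

  -- Edges inside a set of vertices.

  Inside : List V → Edge Γ → Set
  Inside R e = src e ∈ R × tgt e ∈ R

  inside? : ∀ R e → Dec (Inside R e)
  inside? R e = src e ∈? R ×-dec tgt e ∈? R

  Inside-∈ : ∀ {R} e {x} → Inside R e → x ∈ₑ e → x ∈ R
  Inside-∈ e (s∈R , _) (inj₁ refl) = s∈R
  Inside-∈ e (_ , t∈R) (inj₂ refl) = t∈R

  Joins-Inside : ∀ {R} e {x y} → Joins e x y → x ∈ R → y ∈ R → Inside R e
  Joins-Inside {R} e (_ , _ , ends) x∈R y∈R = end (inj₁ refl) , end (inj₂ refl)
    where
    end : ∀ {z} → z ∈ₑ e → z ∈ R
    end z∈e with ends z∈e
    ... | inj₁ refl = x∈R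
    ... | inj₂ refl = y∈R

  fill : List V → Weighting → Weighting → Weighting
  fill R h w e = if does (inside? R e) then h e else w e

  fill-∈ : ∀ {R} h w e → Inside R e → fill R h w e ≡ h e
  fill-∈ {R} h w e i = cong (if_then h e else w e) (dec-true (inside? R e) i)

  fill-∉ : ∀ {R} h w e → ¬ Inside R e → fill R h w e ≡ w e
  fill-∉ {R} h w e i = cong (if_then h e else w e) (dec-false (inside? R e) i)

  fill-↭ : ∀ {R R′} → R ↭ R′ → ∀ h w e → fill R h w e ≡ fill R′ h w e
  fill-↭ {R} {R′} p h w e = cases (inside? R e)
    where
    cases : Dec (Inside R e) → fill R h w e ≡ fill R′ h w e
    cases (yes i@(s , t)) =
      trans (fill-∈ h w e i) (sym (fill-∈ h w e (∈-resp-↭ p s , ∈-resp-↭ p t)))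
    cases (no e∉R) = trans (fill-∉ h w e e∉R) (sym (fill-∉ h w e λ { (s , t) →
      e∉R (∈-resp-↭ (↭-sym p) s , ∈-resp-↭ (↭-sym p) t) }))

  -- B x lists further vertices whose sums that of x has to avoid.
  module _ (d : ℕ) (B : V → List V) (∣B∣≤d : ∀ x → length (B x) ≤ d) where

    Listed : (ℕ → Set) → (Edge Γ → ℕ → ℚ) → Weighting → Edge Γ → Set
    Listed P A w e = ∃[ i ] (P i × w e ≡ A e i)

    -- As A e decreases, `raised' says that every vertex has an edge whose
    -- value is not the smallest one available.
    record Recolouring (R : List V) (k : ℕ) (A : Edge Γ → ℕ → ℚ) (w : Weighting) : Set where
      field
        new    : Weighting
        kept   : ∀ {e} → ¬ Inside R e → new e ≡ w e
        listed : ∀ {e} → Inside R e → Listed (_< k) A new e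
        raised : ∀ {x} → x ∈ R → ∃[ e ] (x ∈ₑ e × Inside R e × Listed (λ i → suc i < k) A new e)
        inner  : ∀ {x y} → x ∈ R → y ∈ R → x ≢ y → Far new x y
        outer  : ∀ {x y} → x ∈ R → y ∈ B x → Far new x y

    set-listed : ∀ (P : ℕ → Set) A w e {i} → P i → ∀ f →
                 Listed P A w f → Listed P A (set w e (A e i)) f
    set-listed P A w e {i} Pi f old with f ≟ₑ e
    ... | yes refl = i , Pi , refl
    ... | no _     = old

    -- The edge `yz` keeps its largest value. First `xz` is chosen to separate `x` from `y` and `z`
    -- from `B z`, then `xy` to separate `x` and `y` from `z` and from `B x` and `B y`. As `xy`
    -- contains both `x` and `y` but not `z`, the second choice does not disturb the first. The
    -- edges `xz` and `yz` witness `raised`.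
    triangle : ∀ {k x y z} → 3 * d + 2 ≤ k → Adj Γ x y → Adj Γ x z → Adj Γ y z →
               let R = x ∷ y ∷ z ∷ [] in
               (∀ {v u} → v ∈ R → u ∈ B v → u ∉ R) →
               ∀ A → (∀ e → Decreasing (suc k) (A e)) → ∀ w → Recolouring R (suc k) A w
    triangle {k} {x} {y} {z} k≥ xy xz yz apart A dec w =
      -- Only the first `k` of the `suc k` values are offered, so `xz` does not get its smallest
      -- value, as `raised` at `x` requires.
      build (choose-weight (λ i<j j<k → dec exz i<j (ℕₚ.m<n⇒m<1+n j<k)) w₀ exz cs₁ sep₁ len₁)
      where
      R = x ∷ y ∷ z ∷ []

      exy exz eyz : Edge Γ
      exy = proj₁ (join {Γ = Γ} xy)
      exz = proj₁ (join {Γ = Γ} xz)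
      eyz = proj₁ (join {Γ = Γ} yz)

      Jxy : Joins exy x y
      Jxy = proj₂ (join {Γ = Γ} xy)
      Jxz : Joins exz x z
      Jxz = proj₂ (join {Γ = Γ} xz)
      Jyz : Joins eyz y z
      Jyz = proj₂ (join {Γ = Γ} yz)

      x∈R : x ∈ R
      x∈R = here refl
      y∈R : y ∈ R
      y∈R = there (here refl)
      z∈R : z ∈ R
      z∈R = there (there (here refl))

      x≢y = Adj⇒≢ {Γ = Γ} xy
      x≢z = Adj⇒≢ {Γ = Γ} xz
      y≢z = Adj⇒≢ {Γ = Γ} yz

      inxy : Inside R exy
      inxy = Joins-Inside exy Jxy x∈R y∈R
      inxz : Inside R exz
      inxz = Joins-Inside exz Jxz x∈R z∈R
      inyz : Inside R eyz
      inyz = Joins-Inside eyz Jyz y∈R z∈R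

      y∉xz : ¬ y ∈ₑ exz
      y∉xz = Joins-∉ exz Jxz (x≢y ∘ sym) y≢z
      z∉xy : ¬ z ∈ₑ exy
      z∉xy = Joins-∉ exy Jxy (x≢z ∘ sym) (y≢z ∘ sym)

      B-avoids : ∀ {v u} e → v ∈ R → u ∈ B v → Inside R e → ¬ u ∈ₑ e
      B-avoids e v∈R u∈B e∈R u∈e = apart v∈R u∈B (Inside-∈ e e∈R u∈e)

      w₀ : Weighting
      w₀ = fill R (λ e → A e 0) w

      cs₁ cs₂ : List (V × V)
      cs₁ = (x , y) ∷ map (z ,_) (B z)
      cs₂ = (x , z) ∷ (y , z) ∷ map (x ,_) (B x) ++ map (y ,_) (B y)

      Separated : Edge Γ → V × V → Set
      Separated e c = proj₁ c ∈ₑ e × ¬ proj₂ c ∈ₑ e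

      sepB : ∀ {v} e → v ∈ R → v ∈ₑ e → Inside R e → All (Separated e) (map (v ,_) (B v))
      sepB e v∈R v∈e e∈R = Allₚ.map⁺ (All.tabulate λ u∈B → v∈e , B-avoids e v∈R u∈B e∈R)

      sep₁ : All (Separated exz) cs₁
      sep₁ = (proj₁ Jxz , y∉xz) ∷ sepB exz z∈R (proj₁ (proj₂ Jxz)) inxz

      sep₂ : All (Separated exy) cs₂
      sep₂ = (proj₁ Jxy , z∉xy) ∷ (proj₁ (proj₂ Jxy) , z∉xy) ∷
             Allₚ.++⁺ (sepB exy x∈R (proj₁ Jxy) inxy) (sepB exy y∈R (proj₁ (proj₂ Jxy)) inxy)

      ∣map∣ : ∀ v → length (map (v ,_) (B v)) ≤ d
      ∣map∣ v = subst (_≤ d) (sym (Listₚ.length-map (v ,_) (B v))) (∣B∣≤d v)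

      2+≤k : ∀ {l} → l ≤ d + d → 2 + l ≤ k
      2+≤k {l} l≤ = ℕₚ.≤-trans (ℕₚ.≤-reflexive (ℕₚ.+-comm 2 l)) (ℕₚ.≤-trans
        (ℕₚ.+-monoˡ-≤ 2 (ℕₚ.≤-trans l≤ (ℕₚ.+-monoʳ-≤ d (ℕₚ.m≤m+n d (d + 0))))) k≥)

      len₁ : length cs₁ < k
      len₁ = 2+≤k (ℕₚ.≤-trans (∣map∣ z) (ℕₚ.m≤m+n d d))

      len₂ : length cs₂ < suc k
      len₂ = s≤s (2+≤k (subst (_≤ d + d) (sym (Listₚ.length-++ (map (x ,_) (B x))))
               (ℕₚ.+-mono-≤ (∣map∣ x) (∣map∣ y))))

      build : ∃[ i ] (i < k × All (λ c → Far (set w₀ exz (A exz i)) (proj₁ c) (proj₂ c)) cs₁) →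
              Recolouring R (suc k) A w
      build (i , i<k , far-xy ∷ far-z) =
        finish (choose-weight (dec exy) w₁ exy cs₂ sep₂ len₂)
        where
        w₁ : Weighting
        w₁ = set w₀ exz (A exz i)

        finish : ∃[ j ] (j < suc k × All (λ c → Far (set w₁ exy (A exy j)) (proj₁ c) (proj₂ c)) cs₂) →
                 Recolouring R (suc k) A w
        finish (j , j<k , far-xz ∷ far-yz ∷ far-xy-B) = record
          { new    = w₂
          ; kept   = λ {e} e∉R → trans (set-≢ w₁ exy e (A exy j) λ { refl → e∉R inxy }) (trans
                       (set-≢ w₀ exz e (A exz i) λ { refl → e∉R inxz }) (fill-∉ (λ e → A e 0) w e e∉R))
          ; listed = λ {e} e∈R → set-listed (_< suc k) A w₁ exy j<k e (set-listed (_< suc k) A w₀ exz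
                       (ℕₚ.m<n⇒m<1+n i<k) e (0 , s≤s z≤n , fill-∈ (λ e → A e 0) w e e∈R))
          ; raised = λ { (here refl)                 → exz , proj₁ Jxz , inxz , raised-xz
                       ; (there (here refl))         → eyz , proj₁ Jyz , inyz , raised-yz
                       ; (there (there (here refl))) → eyz , proj₁ (proj₂ Jyz) , inyz , raised-yz }
          ; inner  = λ { (here refl) (here refl) x≢x → contradiction refl x≢x
                       ; (here refl) (there (here refl)) _ → far-xy₂
                       ; (here refl) (there (there (here refl))) _ → far-xz
                       ; (there (here refl)) (here refl) _ → far-sym far-xy₂
                       ; (there (here refl)) (there (here refl)) y≢y → contradiction refl y≢y
                       ; (there (here refl)) (there (there (here refl))) _ → far-yz
                       ; (there (there (here refl))) (here refl) _ → far-sym far-xz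
                       ; (there (there (here refl))) (there (here refl)) _ → far-sym far-yz
                       ; (there (there (here refl))) (there (there (here refl))) z≢z → contradiction refl z≢z }
          ; outer  = λ { (here refl) u∈B → All.lookup far-xy-B (Anyₚ.++⁺ˡ (∈-map⁺ (x ,_) u∈B))
                       ; (there (here refl)) u∈B →
                           All.lookup far-xy-B (Anyₚ.++⁺ʳ (map (x ,_) (B x)) (∈-map⁺ (y ,_) u∈B))
                       ; (there (there (here refl))) u∈B →
                           far-set exy (A exy j) (inj₁ (z∉xy , B-avoids exy z∈R u∈B inxy))
                             (All.lookup far-z (∈-map⁺ (z ,_) u∈B)) }
          }
          where
          w₂ : Weighting
          w₂ = set w₁ exy (A exy j)

          far-xy₂ : Far w₂ x y
          far-xy₂ = far-set exy (A exy j) (inj₂ (proj₁ Jxy , proj₁ (proj₂ Jxy))) far-xy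

          raised-xz : Listed (λ i → suc i < suc k) A w₂ exz
          raised-xz = i , s≤s i<k , trans
            (set-≢ w₁ exy exz (A exy j) λ eq → z∉xy (subst (z ∈ₑ_) eq (proj₁ (proj₂ Jxz))))
            (set-≡ w₀ exz (A exz i))

          raised-yz : Listed (λ i → suc i < suc k) A w₂ eyz
          raised-yz = 0 , s≤s (ℕₚ.≤-trans (s≤s z≤n) len₁) , trans
            (set-≢ w₁ exy eyz (A exy j) λ eq → z∉xy (subst (z ∈ₑ_) eq (proj₁ (proj₂ Jyz)))) (trans
            (set-≢ w₀ exz eyz (A exz i) λ eq → y∉xz (subst (y ∈ₑ_) eq (proj₁ Jyz)))
            (fill-∈ (λ e → A e 0) w eyz inyz))

    resp-↭ : ∀ {R R′ k A w} → R ↭ R′ → Recolouring R k A w → Recolouring R′ k A w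
    resp-↭ {R} {R′} {k} {A} R↭R′ r = record
      { new    = new
      ; kept   = λ e∉R′ → kept λ { (s , t) → e∉R′ (∈-resp-↭ R↭R′ s , ∈-resp-↭ R↭R′ t) }
      ; listed = λ { (s , t) → listed (back s , back t) }
      ; raised = λ x∈R′ → raised′ (raised (back x∈R′))
      ; inner  = λ x∈R′ y∈R′ → inner (back x∈R′) (back y∈R′)
      ; outer  = λ x∈R′ → outer (back x∈R′)
      }
      where
      open Recolouring r

      back : ∀ {x} → x ∈ R′ → x ∈ R
      back = ∈-resp-↭ (↭-sym R↭R′)

      raised′ : ∀ {x} → ∃[ e ] (x ∈ₑ e × Inside R e × Listed (λ i → suc i < k) A new e) →
                ∃[ e ] (x ∈ₑ e × Inside R′ e × Listed (λ i → suc i < k) A new e)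
      raised′ (e , x∈e , (s , t) , l) = e , x∈e , (∈-resp-↭ R↭R′ s , ∈-resp-↭ R↭R′ t) , l

    -- The d best values of every edge inside R′ are given up, so that an
    -- edge at t may be raised above the level A _ d to satisfy the
    -- constraints of t.  Negating and reversing the remaining values turns
    -- `raised' for R′ into: every x in R′ keeps an edge strictly below that
    -- level, whence t ends up strictly heavier than x.
    heaviest-first : ∀ {k t j R″} → let R′ = j ∷ R″; R = t ∷ R′ in
      1 < k → AllPairs (Adj Γ) R → (∀ {v u} → v ∈ R → u ∈ B v → u ∉ R) →
      ∀ A → (∀ e → Decreasing (d + k) (A e)) → ∀ w →
      All (λ x → weight (fill R (λ e → A e d) w) x ≤ℚ weight (fill R (λ e → A e d) w) t) R′ →
      (∀ A → (∀ e → Decreasing k (A e)) → ∀ w → Recolouring R′ k A w) →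
      Recolouring R (d + k) A w
    heaviest-first {k} {t} {j} {R″} 1<k ((tj ∷ tR″) ∷ adj) apart A dec w heaviest recolour =
      -- At most `d` constraints face the `d + 1` values with indices up to `d`; none of these lies
      -- below the level `A e₀ d`, so the choice cannot make `t` lighter than under `w₀`.
      finish (choose-weight (λ p q → dec e₀ p (ℕₚ.≤-trans q d<k)) w₀ e₀ cs sep len)
      where
      R′ R : List V
      R′ = j ∷ R″
      R  = t ∷ R′

      d<k : d < d + k
      d<k = subst (_< d + k) (ℕₚ.+-identityʳ d) (ℕₚ.+-monoʳ-< d (ℕₚ.<-trans (s≤s z≤n) 1<k))

      t∈R : t ∈ R
      t∈R = here refl

      t-adj : ∀ {x} → x ∈ R′ → Adj Γ t x
      t-adj = All.lookup (tj ∷ tR″)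

      t∉R′ : t ∉ R′
      t∉R′ t∈R′ = Adj⇒≢ {Γ = Γ} (t-adj t∈R′) refl

      inside⁺ : ∀ e → Inside R′ e → Inside R e
      inside⁺ e (s , u) = there s , there u

      inside⁻ : ∀ e → Inside R e → ¬ t ∈ₑ e → Inside R′ e
      inside⁻ e (s , u) t∉e = end s (λ eq → t∉e (inj₁ eq)) , end u (λ eq → t∉e (inj₂ eq))
        where
        end : ∀ {x} → x ∈ R → t ≢ x → x ∈ R′
        end (here refl) t≢t = contradiction refl t≢t
        end (there x∈)  _   = x∈

      t∉inside : ∀ e → Inside R′ e → ¬ t ∈ₑ e
      t∉inside e e∈R′ t∈e = t∉R′ (Inside-∈ e e∈R′ t∈e)

      h w₀ : Weighting
      h  = λ e → A e d
      w₀ = fill R h w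

      e₀ : Edge Γ
      e₀ = proj₁ (join {Γ = Γ} tj)

      J₀ : Joins e₀ t j
      J₀ = proj₂ (join {Γ = Γ} tj)

      t∈e₀ : t ∈ₑ e₀
      t∈e₀ = proj₁ J₀

      e₀∈R : Inside R e₀
      e₀∈R = Joins-Inside e₀ J₀ t∈R (there (here refl))

      cs : List (V × V)
      cs = map (t ,_) (B t)

      sep : All (λ c → proj₁ c ∈ₑ e₀ × ¬ proj₂ c ∈ₑ e₀) cs
      sep = Allₚ.map⁺ (All.tabulate λ u∈B → t∈e₀ , λ u∈e₀ → apart t∈R u∈B (Inside-∈ e₀ e₀∈R u∈e₀))

      len : length cs < suc d
      len = s≤s (subst (_≤ d) (sym (Listₚ.length-map (t ,_) (B t))) (∣B∣≤d t))

      -- Reverses the positions from `d` to `d + k - 1`: index 0 goes to the smallest value and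
      -- `k - 1` to the level `d`. Together with the change of sign in `A′` the values decrease
      -- again.
      ρ : ℕ → ℕ
      ρ i = d + (k ∸ suc i)

      ρ-dec : ∀ {i j} → i < j → j < k → ρ j < ρ i
      ρ-dec i<j j<k = ℕₚ.+-monoʳ-< d (ℕₚ.∸-monoʳ-< (s≤s i<j) j<k)

      ρ<d+k : ∀ {i} → i < k → ρ i < d + k
      ρ<d+k i<k = ℕₚ.+-monoʳ-< d (ℕₚ.∸-monoʳ-< (s≤s z≤n) i<k)

      d<ρ : ∀ {i} → suc i < k → d < ρ i
      d<ρ {i} i<k = subst (_< ρ i) (ℕₚ.+-identityʳ d) (ℕₚ.+-monoʳ-< d (ℕₚ.m<n⇒0<n∸m i<k))

      d≤ρ : ∀ i → d ≤ ρ i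
      d≤ρ i = ℕₚ.m≤m+n d (k ∸ suc i)

      A′ : Edge Γ → ℕ → ℚ
      A′ e i = -ℚ A e (ρ i)

      dec′ : ∀ e → Decreasing k (A′ e)
      dec′ e i<j j<k = ⊏-neg (dec e (ρ-dec i<j j<k) (ρ<d+k (ℕₚ.<-trans i<j j<k)))

      antitone : ∀ e {i j} → i ≤ j → j < d + k → A e j ≤ℚ A e i
      antitone e i≤j j<k with ℕₚ.m≤n⇒m<n∨m≡n i≤j
      ... | inj₁ i<j  = ⊏⇒≤ (dec e i<j j<k)
      ... | inj₂ refl = ℚₚ.≤-refl

      finish : ∃[ i ] (i < suc d × All (λ c → Far (set w₀ e₀ (A e₀ i)) (proj₁ c) (proj₂ c)) cs) →
               Recolouring R (d + k) A w
      finish (i , i≤d , far-t) = record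
        { new    = w₂
        ; kept   = λ {e} e∉R → trans (w₂-kept e (e∉R ∘ inside⁺ e)) (trans
                     (set-≢ w₀ e₀ e (A e₀ i) λ { refl → e∉R e₀∈R }) (fill-∉ h w e e∉R))
        ; listed = λ {e} → w₂-listed e
        ; raised = w₂-raised
        ; inner  = w₂-inner
        ; outer  = w₂-outer
        }
        where
        w₁ : Weighting
        w₁ = set w₀ e₀ (A e₀ i)

        -- The smaller clique is treated from below, by changing the sign of everything; `w₂`
        -- changes it back.
        r : Recolouring R′ k A′ (λ e → -ℚ w₁ e)
        r = recolour A′ dec′ (λ e → -ℚ w₁ e)

        open Recolouring r

        w₂ : Weighting
        w₂ e = -ℚ new e

        w₂-kept : ∀ e → ¬ Inside R′ e → w₂ e ≡ w₁ e
        w₂-kept e e∉R′ = trans (cong -ℚ_ (kept e∉R′)) (neg-involutive (w₁ e))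

        w₂-new : ∀ {e i} → new e ≡ A′ e i → w₂ e ≡ A e (ρ i)
        w₂-new eq = trans (cong -ℚ_ eq) (neg-involutive _)

        w₁-listed : ∀ e → Inside R e → Listed (_≤ d) A w₁ e
        w₁-listed e e∈R = set-listed (_≤ d) A w₀ e₀ (ℕₚ.≤-pred i≤d) e (d , ℕₚ.≤-refl , fill-∈ h w e e∈R)

        w₂-listed : ∀ e → Inside R e → Listed (_< d + k) A w₂ e
        w₂-listed e e∈R = cases (inside? R′ e)
          where
          cases : Dec (Inside R′ e) → Listed (_< d + k) A w₂ e
          cases (yes e∈R′) = let l , l<k , eq = listed e∈R′ in ρ l , ρ<d+k l<k , w₂-new eq
          cases (no e∉R′)  = let l , l≤d , eq = w₁-listed e e∈R in
            l , ℕₚ.≤-<-trans l≤d d<k , trans (w₂-kept e e∉R′) eq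

        t-raised : ∀ e → Inside R e → t ∈ₑ e → Listed (_≤ d) A w₂ e
        t-raised e e∈R t∈e = let l , l≤d , eq = w₁-listed e e∈R in
          l , l≤d , trans (w₂-kept e (λ e∈R′ → t∉inside e e∈R′ t∈e)) eq

        -- Since `1 < k`, an index at most `d` is not the last one. Every vertex of `R` lies on an
        -- edge at `t`, and these edges witness `raised`.
        lift : ∀ {e} → Listed (_≤ d) A w₂ e → Listed (λ i → suc i < d + k) A w₂ e
        lift (l , l≤d , eq) = l , ℕₚ.<-≤-trans (s≤s (s≤s l≤d))
          (subst (_≤ d + k) (ℕₚ.+-comm d 2) (ℕₚ.+-monoʳ-≤ d 1<k)) , eq

        w₂-raised : ∀ {x} → x ∈ R →
                    ∃[ e ] (x ∈ₑ e × Inside R e × Listed (λ i → suc i < d + k) A w₂ e)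
        w₂-raised (here refl) = e₀ , t∈e₀ , e₀∈R , lift (t-raised e₀ e₀∈R t∈e₀)
        w₂-raised (there x∈) = e , proj₁ (proj₂ J) , e∈R , lift (t-raised e e∈R (proj₁ J))
          where
          e = proj₁ (join {Γ = Γ} (t-adj x∈))
          J = proj₂ (join {Γ = Γ} (t-adj x∈))
          e∈R = Joins-Inside e J t∈R (there x∈)

        below : ∀ e → Inside R′ e → w₂ e ≤ℚ w₀ e
        below e e∈R′ = let l , l<k , eq = listed e∈R′ in
          subst₂ _≤ℚ_ (sym (w₂-new eq)) (sym (fill-∈ h w e (inside⁺ e e∈R′))) (antitone e (d≤ρ l) (ρ<d+k l<k))

        above : ∀ e → Inside R e → t ∈ₑ e → w₀ e ≤ℚ w₂ e
        above e e∈R t∈e = let l , l≤d , eq = t-raised e e∈R t∈e in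
          subst₂ _≤ℚ_ (sym (fill-∈ h w e e∈R)) (sym eq) (antitone e l≤d d<k)

        untouched : ∀ e → ¬ Inside R e → w₂ e ≡ w₀ e
        untouched e e∉R =
          trans (w₂-kept e (e∉R ∘ inside⁺ e)) (set-≢ w₀ e₀ e (A e₀ i) λ { refl → e∉R e₀∈R })

        -- Relative to `w₀`, no edge at `t` has dropped and no other edge has risen. The edge
        -- supplied by `raised` meets `x` but not `t` and has an index `ρ l` beyond `d`, so its drop
        -- is a full gap.
        t-heavier : ∀ {x} → x ∈ R′ → D t x w₀ ⊏ D t x w₂
        t-heavier {x} x∈R′ = gain (raised x∈R′)
          where
          up : ∀ f → t ∈ₑ f → w₀ f ≤ℚ w₂ f
          up f t∈f = cases (inside? R f)
            where
            cases : Dec (Inside R f) → w₀ f ≤ℚ w₂ f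
            cases (yes f∈R) = above f f∈R t∈f
            cases (no f∉R)  = ℚₚ.≤-reflexive (sym (untouched f f∉R))

          down : ∀ f → ¬ t ∈ₑ f → w₂ f ≤ℚ w₀ f
          down f t∉f = cases (inside? R f)
            where
            cases : Dec (Inside R f) → w₂ f ≤ℚ w₀ f
            cases (yes f∈R) = below f (inside⁻ f f∈R t∉f)
            cases (no f∉R)  = ℚₚ.≤-reflexive (untouched f f∉R)

          gain : ∃[ e ] (x ∈ₑ e × Inside R′ e × Listed (λ i → suc i < k) A′ new e) →
                 D t x w₀ ⊏ D t x w₂
          gain (e , x∈e , e∈R′ , l , l<k , eq) =
            D-gain t x w₀ w₂ {e} (λ f → δ-≤ t x {w₀} {w₂} {f} (λ t∈f _ → up f t∈f) (λ t∉f _ → down f t∉f))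
              (subst₂ _⊏_ (sym (δ-∉∈ w₀ t∉e x∈e)) (sym (δ-∉∈ w₂ t∉e x∈e))
                (⊏-neg (subst₂ _⊏_ (sym (w₂-new eq)) (sym (fill-∈ h w e (inside⁺ e e∈R′)))
                  (dec e (d<ρ l<k) (ρ<d+k (ℕₚ.<-trans (ℕₚ.n<1+n l) l<k))))))
            where
            t∉e : ¬ t ∈ₑ e
            t∉e = t∉inside e e∈R′

        far-heavier : ∀ {x} → x ∈ R′ → Far w₂ t x
        far-heavier {x} x∈R′ =
          far (0≤⊏⇒far (0≤D t x w₀ (All.lookup heaviest x∈R′)) (t-heavier x∈R′))

        w₂-inner : ∀ {x y} → x ∈ R → y ∈ R → x ≢ y → Far w₂ x y
        w₂-inner (here refl) (here refl) t≢t = contradiction refl t≢t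
        w₂-inner (here refl) (there y∈)  _   = far-heavier y∈
        w₂-inner (there x∈)  (here refl) _   = far-sym (far-heavier x∈)
        w₂-inner (there x∈)  (there y∈)  x≢y = far-neg (inner x∈ y∈ x≢y)

        w₂-outer : ∀ {x y} → x ∈ R → y ∈ B x → Far w₂ x y
        -- The constraints of `t` were met under `w₁`. The edges changed since lie inside `R′`,
        -- which contains neither `t` nor `y`.
        w₂-outer {y = y} (here refl) y∈B = far-cong same (All.lookup far-t (∈-map⁺ (t ,_) y∈B))
          where
          same : ∀ e → w₁ e ≡ w₂ e ⊎ (¬ t ∈ₑ e × ¬ y ∈ₑ e) ⊎ (t ∈ₑ e × y ∈ₑ e)
          same e = cases (inside? R′ e)
            where
            cases : Dec (Inside R′ e) → w₁ e ≡ w₂ e ⊎ (¬ t ∈ₑ e × ¬ y ∈ₑ e) ⊎ (t ∈ₑ e × y ∈ₑ e)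
            cases (yes e∈R′) = inj₂ (inj₁ (t∉inside e e∈R′ ,
                                 λ y∈e → apart t∈R y∈B (Inside-∈ e (inside⁺ e e∈R′) y∈e)))
            cases (no e∉R′)  = inj₁ (sym (w₂-kept e e∉R′))
        w₂-outer (there x∈) y∈B = far-neg (outer x∈ y∈B)

    -- Each vertex beyond the last three is split off by `heaviest-first` at the price of `d`
    -- values, which leaves `k ∸ d` for the others. The induction quantifies over `A` and `w`
    -- because the smaller clique is met with negated, reversed lists and an altered weighting.
    clique : ∀ m {k} R → length R ≡ 3 + m → AllPairs (Adj Γ) R →
             (∀ {v u} → v ∈ R → u ∈ B v → u ∉ R) → (3 + m) * d + 3 ≤ k →
             ∀ A → (∀ e → Decreasing k (A e)) → ∀ w → Recolouring R k A w
    clique zero {k} (x ∷ y ∷ z ∷ []) refl ((xy ∷ xz ∷ []) ∷ (yz ∷ []) ∷ [] ∷ []) apart k≥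
      -- Matching on the bound exposes `k` as a successor and turns `3 * d + 3` into the `3 * d + 2`
      -- of `triangle`.
      with s≤s k′≥ ← subst (_≤ k) (ℕₚ.+-suc (3 * d) 2) k≥ = triangle k′≥ xy xz yz apart
    clique (suc m) {k} (x ∷ xs) len adj apart k≥ A dec w =
      extend (extract-max (weight (fill (x ∷ xs) (λ e → A e d) w)) x xs)
      where
      k-d≥ : d + ((3 + m) * d + 3) ≤ k
      k-d≥ = subst (_≤ k) (ℕₚ.+-assoc d ((3 + m) * d) 3) k≥

      d+[k-d]≡k : d + (k ∸ d) ≡ k
      d+[k-d]≡k = ℕₚ.m+[n∸m]≡n (ℕₚ.m+n≤o⇒m≤o d k-d≥)

      rest≤ : (3 + m) * d + 3 ≤ k ∸ d
      rest≤ = ℕₚ.m+n≤o⇒m≤o∸n _ (subst (_≤ k) (ℕₚ.+-comm d _) k-d≥)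

      1<k-d : 1 < k ∸ d
      1<k-d = ℕₚ.≤-trans (s≤s (s≤s z≤n)) (ℕₚ.≤-trans (ℕₚ.m≤n+m 3 ((3 + m) * d)) rest≤)

      extend : ∃[ t ] ∃[ ys ] ((x ∷ xs) ↭ (t ∷ ys) ×
                 All (λ z → weight (fill (x ∷ xs) (λ e → A e d) w) z ≤ℚ
                            weight (fill (x ∷ xs) (λ e → A e d) w) t) ys) →
               Recolouring (x ∷ xs) k A w
      extend (t , [] , p , _) with () ← trans (sym len) (↭-length p)
      extend (t , j ∷ ys , p , heaviest) = subst (λ k → Recolouring (x ∷ xs) k A w) d+[k-d]≡k
        (resp-↭ (↭-sym p) (heaviest-first 1<k-d adj′ apart′ A
          (λ e → subst (λ k → Decreasing k (A e)) (sym d+[k-d]≡k) (dec e)) w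
          (All.map (λ {z} → subst₂ _≤ℚ_ (weight-fill z) (weight-fill t)) heaviest)
          (clique m (j ∷ ys) (ℕₚ.suc-injective (trans (sym (↭-length p)) len)) (tail adj′)
            (λ v∈ u∈B u∈ → apart′ (there v∈) u∈B (there u∈)) rest≤)))
        where
        adj′ : AllPairs (Adj Γ) (t ∷ j ∷ ys)
        adj′ = Permₛ.AllPairs-resp-↭ (setoid V) (symm Γ) (resp₂ (Adj Γ)) (↭⇒↭ₛ p) adj

        apart′ : ∀ {v u} → v ∈ t ∷ j ∷ ys → u ∈ B v → u ∉ t ∷ j ∷ ys
        apart′ v∈ u∈B u∈ = apart (∈-resp-↭ (↭-sym p) v∈) u∈B (∈-resp-↭ (↭-sym p) u∈)

        weight-fill : ∀ z → weight (fill (x ∷ xs) (λ e → A e d) w) z ≡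
                            weight (fill (t ∷ j ∷ ys) (λ e → A e d) w) z
        weight-fill z = weight-cong z (fill-↭ p (λ e → A e d) w)

-- The product with a complete graph

elements : ∀ {n} → Subset n → List (Fin n)
elements []            = []
elements (true ∷ p)  = zero ∷ map suc (elements p)
elements (false ∷ p) = map suc (elements p)

length-elements : ∀ {n} (p : Subset n) → length (elements p) ≡ ∣ p ∣
length-elements []            = refl
length-elements (true ∷ p)  = cong suc (trans (Listₚ.length-map suc (elements p)) (length-elements p))
length-elements (false ∷ p) = trans (Listₚ.length-map suc (elements p)) (length-elements p)

∈-elements⁺ : ∀ {n} {p : Subset n} {x} → x ∈ₛ p → x ∈ elements p
∈-elements⁺ {p = true ∷ p}  hereᵥ        = here refl
∈-elements⁺ {p = true ∷ p}  (thereᵥ x∈p) = there (∈-map⁺ suc (∈-elements⁺ x∈p))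
∈-elements⁺ {p = false ∷ p} (thereᵥ x∈p) = ∈-map⁺ suc (∈-elements⁺ x∈p)

∈-elements⁻ : ∀ {n} (p : Subset n) {x} → x ∈ elements p → x ∈ₛ p
∈-elements⁻ (true ∷ p)  (here refl) = hereᵥ
∈-elements⁻ (true ∷ p)  (there x∈) with _ , y∈ , refl ← ∈-map⁻ suc x∈ = thereᵥ (∈-elements⁻ p y∈)
∈-elements⁻ (false ∷ p) x∈         with _ , y∈ , refl ← ∈-map⁻ suc x∈ = thereᵥ (∈-elements⁻ p y∈)

module _ {n} (G : Graph n) where

  ∈-neighbours⁺ : ∀ {v u} → Adj G v u → u ∈ₛ neighbours G v
  ∈-neighbours⁺ {v} {u} vu = Vecₚ.lookup⇒[]= u (neighbours G v)
    (trans (Vecₚ.lookup∘tabulate (λ u → does (adj? G v u)) u) (dec-true (adj? G v u) vu))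

  ∈-neighbours⁻ : ∀ {v u} → u ∈ₛ neighbours G v → Adj G v u
  ∈-neighbours⁻ {v} {u} u∈ = holds (adj? G v u)
    (trans (sym (Vecₚ.lookup∘tabulate (λ u → does (adj? G v u)) u)) (Vecₚ.[]=⇒lookup u∈))
    where
    holds : ∀ {P : Set} (p? : Dec P) → does p? ≡ true → P
    holds (yes p) _ = p

module _ {N} n d {η} (0≤η : 0ℚ ≤ℚ η) (3≤n : 3 ≤ n) (G : Graph N)
         (A : Edge (G □ complete n) → ℕ → ℚ)
         (dec : ∀ e → Decreasing {Γ = G □ complete n} η 0≤η (n * d + 3) (A e)) where

  private
    Γ = G □ complete n
    V = Fin (N * n)

    col : V → Fin N
    col x = proj₁ (remQuot {N} n x)

    row : V → Fin n
    row x = proj₂ (remQuot {N} n x)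

  -- The invariant of the induction: all edges carry values from their lists, but only the copies
  -- indexed by `S` have to be coloured properly so far.
  Coloured : Subset N → Set
  Coloured S = ∃[ w ] ((∀ e → ∃[ i ] (i < n * d + 3 × w e ≡ A e i)) ×
                       (∀ {x y} → col x ∈ₛ S → col y ∈ₛ S → Adj Γ x y → Far {Γ = Γ} η 0≤η w x y))

  module _ {S v} (few : ∣ S ∩ neighbours G v ∣ ≤ d) where

    private
      copy : List V
      copy = tabulate (combine v)

      -- For `x` in the copy of `v`, these are its neighbours in the other copies indexed by `S`;
      -- they all lie in the row of `x`.
      B : V → List V
      B x = map (λ u → combine u (row x)) (elements (S ∩ neighbours G v))

      col-combine : ∀ u i → col (combine u i) ≡ u
      col-combine u i = cong proj₁ (Finₚ.remQuot-combine {N} {n} u i)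

      row-combine : ∀ u i → row (combine {N} u i) ≡ i
      row-combine u i = cong proj₂ (Finₚ.remQuot-combine {N} {n} u i)

      combine-col-row : ∀ x → combine (col x) (row x) ≡ x
      combine-col-row = Finₚ.combine-remQuot {N} n

      ∈-copy⁺ : ∀ {x} → col x ≡ v → x ∈ copy
      ∈-copy⁺ {x} eq = subst (_∈ copy) (trans (cong (λ u → combine u (row x)) (sym eq)) (combine-col-row x))
        (∈-tabulate⁺ (row x))

      ∈-copy⁻ : ∀ {x} → x ∈ copy → col x ≡ v
      ∈-copy⁻ x∈ = let i , eq = ∈-tabulate⁻ x∈ in trans (cong col eq) (col-combine v i)

      copy-clique : AllPairs (Adj Γ) copy
      copy-clique = AllPairsₚ.tabulate⁺ λ {i} {j} i≢j → inj₁
        ( trans (col-combine v i) (sym (col-combine v j))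
        , λ eq → i≢j (trans (sym (row-combine v i)) (trans eq (row-combine v j))) )

      ∣B∣≤d : ∀ x → length (B x) ≤ d
      ∣B∣≤d x = subst (_≤ d) (sym (trans (Listₚ.length-map _ (elements (S ∩ neighbours G v)))
                  (length-elements (S ∩ neighbours G v)))) few

      B-outside : ∀ {x y} → x ∈ copy → y ∈ B x → y ∉ copy
      B-outside {x} _ y∈B y∈copy =
        let u , u∈ , eq = ∈-map⁻ (λ u → combine u (row x)) y∈B
            u≡v = trans (sym (col-combine u (row x))) (trans (cong col (sym eq)) (∈-copy⁻ y∈copy))
        in irrefl G (sym u≡v)
             (∈-neighbours⁻ G (proj₂ (x∈p∩q⁻ S _ (∈-elements⁻ (S ∩ neighbours G v) u∈))))

      n≡3+m : n ≡ 3 + (n ∸ 3)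
      n≡3+m = sym (ℕₚ.m+[n∸m]≡n 3≤n)

    -- Only edges inside the copy of `v` change, and they meet no vertex of another copy, so earlier
    -- separations persist by `far-cong`. The new ones are `inner` within the copy and `outer`
    -- towards the copies already treated.
    recolour-copy : Coloured (S - v) → Coloured S
    recolour-copy (w , w-listed , w-far) = new , new-listed , new-far
      where
      open Recolouring (clique η 0≤η d B ∣B∣≤d (n ∸ 3) copy (trans (Listₚ.length-tabulate _) n≡3+m)
        copy-clique B-outside (ℕₚ.≤-reflexive (cong (λ l → l * d + 3) (sym n≡3+m))) A dec w)

      new-listed : ∀ e → ∃[ i ] (i < n * d + 3 × new e ≡ A e i)
      new-listed e = cases (inside? η 0≤η copy e)
        where
        cases : Dec (Inside η 0≤η copy e) → ∃[ i ] (i < n * d + 3 × new e ≡ A e i)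
        cases (yes e∈) = listed e∈
        cases (no e∉)  = let i , i<k , eq = w-listed e in i , i<k , trans (kept e∉) eq

      far-copy : ∀ {x y} → col x ≡ v → col y ≢ v → col y ∈ₛ S → Adj Γ x y → Far η 0≤η new x y
      far-copy x∈ y∉ y∈S (inj₁ (eq , _)) = contradiction (trans (sym eq) x∈) y∉
      far-copy {x} {y} x∈ y∉ y∈S (inj₂ (eq , xy)) = outer (∈-copy⁺ x∈)
        (subst (_∈ B x) (trans (cong (combine (col y)) eq) (combine-col-row y))
          (∈-map⁺ (λ u → combine u (row x)) (∈-elements⁺ (x∈p∩q⁺ (y∈S ,
            ∈-neighbours⁺ G (subst (λ u → Adj G u (col y)) x∈ xy))))))

      new-far : ∀ {x y} → col x ∈ₛ S → col y ∈ₛ S → Adj Γ x y → Far η 0≤η new x y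
      new-far {x} {y} x∈S y∈S xy = cases (col x ≟ v) (col y ≟ v)
        where
        cases : Dec (col x ≡ v) → Dec (col y ≡ v) → Far η 0≤η new x y
        cases (yes x∈) (yes y∈) = inner (∈-copy⁺ x∈) (∈-copy⁺ y∈) (Adj⇒≢ {Γ = Γ} xy)
        cases (yes x∈) (no y∉)  = far-copy x∈ y∉ y∈S xy
        cases (no x∉)  (yes y∈) = far-sym η 0≤η (far-copy y∈ x∉ x∈S (symm Γ {x} {y} xy))
        cases (no x∉)  (no y∉)  = far-cong η 0≤η same
          (w-far (x∈p∧x≢y⇒x∈p-y x∈S x∉) (x∈p∧x≢y⇒x∈p-y y∈S y∉) xy)
          where
          same : ∀ e → w e ≡ new e ⊎ (¬ x ∈ₑ e × ¬ y ∈ₑ e) ⊎ (x ∈ₑ e × y ∈ₑ e)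
          same e = change (inside? η 0≤η copy e)
            where
            change : Dec (Inside η 0≤η copy e) →
                     w e ≡ new e ⊎ (¬ x ∈ₑ e × ¬ y ∈ₑ e) ⊎ (x ∈ₑ e × y ∈ₑ e)
            change (yes e∈) = inj₂ (inj₁
              ( (λ x∈e → x∉ (∈-copy⁻ (Inside-∈ η 0≤η e e∈ x∈e)))
              , (λ y∈e → y∉ (∈-copy⁻ (Inside-∈ η 0≤η e e∈ y∈e)))))
            change (no e∉)  = inj₁ (sym (kept e∉))

  -- Degeneracy supplies `v` with at most `d` neighbours in `S`, whose copy is treated after those
  -- of `S - v`. The bound `s` makes the recursion structural.
  colour : Degenerate d G → ∀ s S → ∣ S ∣ ≤ s → Coloured S
  colour degenerate s S ∣S∣≤s with nonempty? S
  -- Every edge starts at its largest value; edges between different copies keep it for good.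
  ... | no empty = (λ e → A e 0)
                 , (λ e → 0 , ℕₚ.≤-trans (s≤s z≤n) (ℕₚ.m≤n+m 3 (n * d)) , refl)
                 , λ x∈S → contradiction (_ , x∈S) empty
  colour degenerate s S ∣S∣≤s | yes S≠∅ with v , v∈S , few ← degenerate S S≠∅ =
    recolour-copy few (smaller s (ℕₚ.≤-trans (x∈p⇒∣p-x∣<∣p∣ v∈S) ∣S∣≤s))
    where
    smaller : ∀ s → ∣ S - v ∣ < s → Coloured (S - v)
    smaller (suc s) (s≤s ≤s) = colour degenerate s (S - v) ≤s

-- From rational to real weights

nth : List ℚ → ℕ → ℚ
nth []       _       = 0ℚ
nth (x ∷ xs) zero    = x
nth (x ∷ xs) (suc i) = nth xs i

nth-∈ : ∀ xs {i} → i < length xs → nth xs i ∈ xs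
nth-∈ (x ∷ xs) {zero}  _         = here refl
nth-∈ (x ∷ xs) {suc i} (s≤s i<l) = there (nth-∈ xs i<l)

nth-pairs : ∀ {R : ℚ → ℚ → Set} {xs i j} → AllPairs R xs → i < j → j < length xs → R (nth xs i) (nth xs j)
nth-pairs {i = zero}  {suc j} (x~xs ∷ _) _         (s≤s j<l) = All.lookup x~xs (nth-∈ _ j<l)
nth-pairs {i = suc i} {suc j} (_ ∷ xs)   (s≤s i<j) (s≤s j<l) = nth-pairs xs i<j j<l

module _ {c : ℚ} where

  private
    _≫_ : ℚ → ℚ → Set
    x ≫ y = y +ℚ c ≤ℚ x

    ≫-of-far : ∀ {x y} → y ≤ℚ x → c ≤ℚ ∣ x -ℚ y ∣ℚ → x ≫ y
    ≫-of-far {x} {y} y≤x c≤ = ≤-by (subst (c ≤ℚ_)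
      (ℚₚ.0≤p⇒∣p∣≡p (≤-by y≤x (ℚₚ.+-identityʳ (x -ℚ y)))) c≤)
      (solve 3 (λ x y c → x :- (y :+ c) := (x :- y) :- c) refl x y c)
      where open +-*-Solver

  -- Comparing `x` with `y` turns their distance into a one-sided gap, and transitivity through `y`
  -- covers the elements after it.
  insert-decreasing : ∀ x {ys} → All (λ y → c ≤ℚ ∣ x -ℚ y ∣ℚ) ys → AllPairs _≫_ ys →
                      ∃[ zs ] (zs ↭ x ∷ ys × AllPairs _≫_ zs)
  insert-decreasing x []          []            = x ∷ [] , ↭-refl , [] ∷ []
  insert-decreasing x {y ∷ ys} (x#y ∷ x#ys) (y≫ys ∷ ≫ys) with ℚₚ.≤-total y x
  ... | inj₁ y≤x = x ∷ y ∷ ys , ↭-refl ,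
          (≫-of-far y≤x x#y ∷ All.map (λ z≪y → ℚₚ.≤-trans z≪y y≤x) y≫ys) ∷ y≫ys ∷ ≫ys
  ... | inj₂ x≤y with zs , p , ≫zs ← insert-decreasing x x#ys ≫ys =
          y ∷ zs , ↭-trans (↭-prep y p) (↭-swap y x ↭-refl) ,
          All-resp-↭ (↭-sym p) (≫-of-far x≤y (subst (c ≤ℚ_) flip x#y) ∷ y≫ys) ∷ ≫zs
    where
    open +-*-Solver
    flip : ∣ x -ℚ y ∣ℚ ≡ ∣ y -ℚ x ∣ℚ
    flip = trans (sym (ℚₚ.∣-p∣≡∣p∣ (x -ℚ y))) (cong ∣_∣ℚ (solve 2 (λ x y → :- (x :- y) := y :- x) refl x y))

  sort-decreasing : ∀ {xs} → AllPairs (λ x y → c ≤ℚ ∣ x -ℚ y ∣ℚ) xs → ∃[ zs ] (zs ↭ xs × AllPairs _≫_ zs)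
  sort-decreasing []                 = [] , ↭-refl , []
  sort-decreasing {x ∷ xs} (x#xs ∷ #xs) =
    let ys , p , ≫ys = sort-decreasing #xs
        zs , q , ≫zs = insert-decreasing x (All-resp-↭ (↭-sym p) x#xs) ≫ys
    in zs , ↭-trans q (↭-prep x p) , ≫zs

-- Uniform gaps and moduli for finitely many reals.

Threshold : (ℚ → ℕ → Set) → Set
Threshold K = ∃[ ε ] ∃[ N ] (0ℚ <ℚ ε × (∀ {n} → N ≤ n → K ε n))

Antitone : (ℚ → ℕ → Set) → Set
Antitone K = ∀ {ε ε′ n} → ε′ ≤ℚ ε → K ε n → K ε′ n

-- `x # y` unfolds to `Threshold (Gap x y)`. Conditions that persist when `ε` shrinks can be met
-- together, with the smaller `ε` and the later index.
threshold-× : ∀ {J K} → Antitone J → Antitone K → Threshold J → Threshold K →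
              Threshold (λ ε n → J ε n × K ε n)
threshold-× {J} {K} antiJ antiK (ε , N , 0<ε , j) (ε′ , N′ , 0<ε′ , k) =
  smaller (ℚₚ.≤-total ε ε′)
  where
  smaller : ε ≤ℚ ε′ ⊎ ε′ ≤ℚ ε → Threshold (λ ε n → J ε n × K ε n)
  smaller (inj₁ ε≤ε′) = ε , N ⊔ N′ , 0<ε , λ {n} N≤n →
    j (ℕₚ.m⊔n≤o⇒m≤o N N′ N≤n) , antiK {n = n} ε≤ε′ (k (ℕₚ.m⊔n≤o⇒n≤o N N′ N≤n))
  smaller (inj₂ ε′≤ε) = ε′ , N ⊔ N′ , 0<ε′ , λ {n} N≤n →
    antiJ {n = n} ε′≤ε (j (ℕₚ.m⊔n≤o⇒m≤o N N′ N≤n)) , k (ℕₚ.m⊔n≤o⇒n≤o N N′ N≤n)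

threshold-All : ∀ {A : Set} {K : A → ℚ → ℕ → Set} → (∀ x → Antitone (K x)) → ∀ xs →
                (∀ {x} → x ∈ xs → Threshold (K x)) → Threshold (λ ε n → All (λ x → K x ε n) xs)
threshold-All anti []       _   = 1ℚ , 0 , ℚₚ.positive⁻¹ 1ℚ , λ _ → []
threshold-All {K = K} anti (x ∷ xs) thr
  with ε , N , 0<ε , all ← threshold-× (anti x) (λ ε′≤ε → All.map (λ {y} → anti y ε′≤ε))
         (thr (here refl)) (threshold-All {K = K} anti xs (thr ∘ there))
  = ε , N , 0<ε , λ N≤n → let p , ps = all N≤n in p ∷ ps

Gap : ℝ → ℝ → ℚ → ℕ → Set
Gap x y ε n = ε ≤ℚ ∣ seq x n -ℚ seq y n ∣ℚ

gap-antitone : ∀ x y → Antitone (Gap x y)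
gap-antitone x y = ℚₚ.≤-trans

threshold-AllPairs : ∀ {xs} → AllPairs _#_ xs → Threshold (λ ε n → AllPairs (λ x y → Gap x y ε n) xs)
threshold-AllPairs []           = 1ℚ , 0 , ℚₚ.positive⁻¹ 1ℚ , λ _ → []
threshold-AllPairs {x ∷ xs} (x#xs ∷ #xs)
  with ε , N , 0<ε , all ← threshold-×
         (λ ε′≤ε → All.map (ℚₚ.≤-trans ε′≤ε)) (λ ε′≤ε → AllPairs.map (ℚₚ.≤-trans ε′≤ε))
         (threshold-All {K = Gap x} (gap-antitone x) xs (All.lookup x#xs)) (threshold-AllPairs #xs)
  = ε , N , 0<ε , λ N≤n → let p , ps = all N≤n in p ∷ ps

uniform-cauchy : ∀ {δ} → 0ℚ <ℚ δ → ∀ xs → ∃[ N ] (∀ {m n} → N ≤ m → N ≤ n →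
                 All (λ x → ∣ seq x m -ℚ seq x n ∣ℚ <ℚ δ) xs)
uniform-cauchy 0<δ []       = 0 , λ _ _ → []
uniform-cauchy 0<δ (x ∷ xs) =
  let N  , near  = cauchy x 0<δ
      N′ , nears = uniform-cauchy 0<δ xs
  in N ⊔ N′ , λ m≥ n≥ → near (ℕₚ.m⊔n≤o⇒m≤o N N′ m≥) (ℕₚ.m⊔n≤o⇒m≤o N N′ n≥)
                      ∷ nears (ℕₚ.m⊔n≤o⇒n≤o N N′ m≥) (ℕₚ.m⊔n≤o⇒n≤o N N′ n≥)

halve : ∀ {ε} → 0ℚ <ℚ ε → ∃[ h ] (0ℚ <ℚ h × h +ℚ h ≡ ε)
halve {ε} 0<ε = ε *ℚ ½ , subst (_<ℚ ε *ℚ ½) (ℚₚ.*-zeroˡ ½) (ℚₚ.*-monoˡ-<-pos ½ 0<ε) ,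
  trans (sym (ℚₚ.*-distribˡ-+ ε ½ ½)) (ℚₚ.*-identityʳ ε)

-- Half of `ε` is reserved for the first summand and half for the remaining sum; `δ` is the smaller
-- of the two resulting bounds.
total-continuous : ∀ {A : Set} (xs : List A) {ε} → 0ℚ <ℚ ε → ∃[ δ ] (0ℚ <ℚ δ ×
  (∀ f g → (∀ x → ∣ f x -ℚ g x ∣ℚ <ℚ δ) → ∣ total xs f -ℚ total xs g ∣ℚ <ℚ ε))
total-continuous []       {ε} 0<ε = ε , 0<ε , λ _ _ _ → 0<ε
total-continuous {A} (x ∷ xs) {ε} 0<ε with halve 0<ε
... | h , 0<h , h+h≡ε with total-continuous xs 0<h
...   | δ , 0<δ , close = smaller (ℚₚ.≤-total h δ)
  where
  open +-*-Solver

  step : ∀ f g → ∣ f x -ℚ g x ∣ℚ <ℚ h → (∀ x → ∣ f x -ℚ g x ∣ℚ <ℚ δ) →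
         ∣ total (x ∷ xs) f -ℚ total (x ∷ xs) g ∣ℚ <ℚ ε
  step f g near nears = subst₂ _<ℚ_
    (cong ∣_∣ℚ (solve 4 (λ a b c d → (a :- b) :+ (c :- d) := (a :+ c) :- (b :+ d)) refl
      (f x) (g x) (total xs f) (total xs g)))
    h+h≡ε
    (ℚₚ.≤-<-trans (ℚₚ.∣p+q∣≤∣p∣+∣q∣ (f x -ℚ g x) (total xs f -ℚ total xs g))
      (ℚₚ.+-mono-< near (close f g nears)))

  smaller : h ≤ℚ δ ⊎ δ ≤ℚ h → ∃[ δ ] (0ℚ <ℚ δ × (∀ f g → (∀ x → ∣ f x -ℚ g x ∣ℚ <ℚ δ) →
            ∣ total (x ∷ xs) f -ℚ total (x ∷ xs) g ∣ℚ <ℚ ε))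
  smaller (inj₁ h≤δ) = h , 0<h , λ f g nears → step f g (nears x) λ y → ℚₚ.<-≤-trans (nears y) h≤δ
  smaller (inj₂ δ≤h) = δ , 0<δ , λ f g nears → step f g (ℚₚ.<-≤-trans (nears x) δ≤h) nears

-- The triangle inequality through `a′` and `b′` loses at most `2q = h` of the original `2h`.
difference-stable : ∀ {a b a′ b′ h q} → q +ℚ q ≡ h → h +ℚ h ≤ℚ ∣ a -ℚ b ∣ℚ →
                    ∣ a -ℚ a′ ∣ℚ <ℚ q → ∣ b -ℚ b′ ∣ℚ <ℚ q → h ≤ℚ ∣ a′ -ℚ b′ ∣ℚ
difference-stable {a} {b} {a′} {b′} {h} {q} q+q≡h gap a~a′ b~b′ = ≤-by
  (ℚₚ.+-mono-≤ (ℚₚ.≤-trans gap split) (ℚₚ.+-mono-≤ (ℚₚ.<⇒≤ a~a′) (ℚₚ.<⇒≤ b~b′)))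
  (trans (cong (λ s → Z -ℚ s) (sym q+q≡h)) (trans
    (solve 4 (λ X Y Z q → Z :- (q :+ q) := ((X :+ (Y :+ Z)) :+ (q :+ q)) :- (((q :+ q) :+ (q :+ q)) :+ (X :+ Y)))
      refl X Y Z q)
    (cong (λ h → ((X +ℚ (Y +ℚ Z)) +ℚ (q +ℚ q)) -ℚ ((h +ℚ h) +ℚ (X +ℚ Y))) q+q≡h)))
  where
  open +-*-Solver
  X = ∣ a -ℚ a′ ∣ℚ
  Y = ∣ b -ℚ b′ ∣ℚ
  Z = ∣ a′ -ℚ b′ ∣ℚ

  split : ∣ a -ℚ b ∣ℚ ≤ℚ X +ℚ (Y +ℚ Z)
  split = subst (_≤ℚ X +ℚ (Y +ℚ Z))
    (cong ∣_∣ℚ (solve 4 (λ a b a′ b′ → (a :- a′) :+ ((:- (b :- b′)) :+ (a′ :- b′)) := a :- b) refl a b a′ b′))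
    (ℚₚ.≤-trans (ℚₚ.∣p+q∣≤∣p∣+∣q∣ (a -ℚ a′) (-ℚ (b -ℚ b′) +ℚ (a′ -ℚ b′)))
      (ℚₚ.+-monoʳ-≤ X (subst (λ Y → ∣ -ℚ (b -ℚ b′) +ℚ (a′ -ℚ b′) ∣ℚ ≤ℚ Y +ℚ Z) (ℚₚ.∣-p∣≡∣p∣ (b -ℚ b′))
        (ℚₚ.∣p+q∣≤∣p∣+∣q∣ (-ℚ (b -ℚ b′)) (a′ -ℚ b′)))))

-- Links `vertexSum`, which filters the edges, to `weight`, which adds 0 for the edges elsewhere.
seq-sum-filter : ∀ {A : Set} {P : A → Set} (P? : ∀ x → Dec (P x)) (f : A → ℝ) n xs →
                 seq (sumℝ (map f (filter P? xs))) n ≡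
                 total xs (λ x → if does (P? x) then seq (f x) n else 0ℚ)
seq-sum-filter P? f n []       = refl
seq-sum-filter {P = P} P? f n (x ∷ xs) = cases (P? x)
  where
  sum : List _ → ℚ
  sum ys = seq (sumℝ (map f ys)) n

  rest : ℚ
  rest = total xs (λ x → if does (P? x) then seq (f x) n else 0ℚ)

  cases : Dec (P x) → sum (filter P? (x ∷ xs)) ≡ (if does (P? x) then seq (f x) n else 0ℚ) +ℚ rest
  cases (yes p) = trans (cong sum (Listₚ.filter-accept P? p)) (cong₂ _+ℚ_
    (cong (if_then seq (f x) n else 0ℚ) (sym (dec-true (P? x) p))) (seq-sum-filter P? f n xs))
  cases (no ¬p) = trans (cong sum (Listₚ.filter-reject P? ¬p)) (trans (seq-sum-filter P? f n xs) (trans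
    (sym (ℚₚ.+-identityˡ rest))
    (cong (λ b → (if b then seq (f x) n else 0ℚ) +ℚ rest) (sym (dec-false (P? x) ¬p)))))

if-near : ∀ b {p q δ} → 0ℚ <ℚ δ → ∣ p -ℚ q ∣ℚ <ℚ δ →
          ∣ (if b then p else 0ℚ) -ℚ (if b then q else 0ℚ) ∣ℚ <ℚ δ
if-near true  _   p~q = p~q
if-near false 0<δ _   = 0<δ

-- Rational approximations of the lists at a late index.

module _ {M} {Γ : Graph M} {k : ℕ} (L : Edge Γ → Vec ℝ k) where

  private
    valuesAt : ℕ → Edge Γ → List ℚ
    valuesAt n e = map (λ x → seq x n) (toList (L e))

  separated : (∀ e → Vecᴾ.AllPairs _#_ (L e)) →
              Threshold (λ ε n → ∀ e → AllPairs (λ x y → ε ≤ℚ ∣ x -ℚ y ∣ℚ) (valuesAt n e))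
  separated #L =
    let ε , N , 0<ε , all = threshold-All
          {K = λ e ε n → AllPairs (λ x y → Gap x y ε n) (toList (L e))}
          (λ e ε′≤ε → AllPairs.map (ℚₚ.≤-trans ε′≤ε)) (edges Γ)
          (λ {e} _ → threshold-AllPairs (pairs (#L e)))
    in ε , N , 0<ε , λ N≤n e → AllPairsₚ.map⁺ (All.lookup (all N≤n) (∈-edges e))
    where
    alls : ∀ {n} x {ys : Vec ℝ n} → Vecᴬ.All (x #_) ys → All (x #_) (toList ys)
    alls x Vecᴬ.[]       = []
    alls x (p Vecᴬ.∷ ps) = p ∷ alls x ps

    pairs : ∀ {n} {ys : Vec ℝ n} → Vecᴾ.AllPairs _#_ ys → AllPairs _#_ (toList ys)
    pairs Vecᴾ.[]                         = []
    pairs {ys = x ∷ _} (p Vecᴾ.∷ ps) = alls x p ∷ pairs ps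

  stable : ∀ {δ} → 0ℚ <ℚ δ → ∃[ N ] (∀ {m n} → N ≤ m → N ≤ n →
           ∀ {e x} → x ∈ toList (L e) → ∣ seq x m -ℚ seq x n ∣ℚ <ℚ δ)
  stable 0<δ =
    let N , near = uniform-cauchy 0<δ (concatMap (toList ∘ L) (edges Γ))
    in N , λ m≥ n≥ {e} x∈ → All.lookup (near m≥ n≥)
         (∈-concatMap⁺ (toList ∘ L) (Any.map (λ { refl → x∈ }) (∈-edges e)))

module _ {N} n d (3≤n : 3 ≤ n) (G : Graph N) (degenerate : Degenerate d G) where

  private
    Γ = G □ complete n
    k = n * d + 3

  product-choosable : SumChoosable Γ k
  product-choosable L #L =
    -- The lists are separated by `ε = 2η`, the gap that `Decreasing` demands, so the rational sums
    -- come out `η` apart. A drift of each sum below `q = η/4` leaves them `h = η/2` apart, and `δ`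
    -- is the drift allowed to single weights.
    let ε , N₁ , 0<ε , sep     = separated L #L
        η , 0<η , η+η≡ε        = halve 0<ε
        h , 0<h , h+h≡η        = halve 0<η
        q , 0<q , q+q≡h        = halve 0<h
        δ , 0<δ , close        = total-continuous (edges Γ) 0<q
        N₂ , near              = stable L 0<δ
    in select ε η h q δ (N₁ ⊔ N₂) (ℚₚ.<⇒≤ 0<η) η+η≡ε 0<h h+h≡η q+q≡h 0<δ close
         (sep (ℕₚ.m≤m⊔n N₁ N₂)) (near (ℕₚ.m≤n⊔m N₁ N₂) ∘ ℕₚ.≤-trans (ℕₚ.m≤n⊔m N₁ N₂))
    where
    -- With the constants abstracted to variables, the equations between them can be matched with
    -- `refl`.
    select : ∀ ε η h q δ m → (0≤η : 0ℚ ≤ℚ η) → η +ℚ η ≡ ε → 0ℚ <ℚ h → h +ℚ h ≡ η → q +ℚ q ≡ h → 0ℚ <ℚ δ →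
      (∀ f g → (∀ x → ∣ f x -ℚ g x ∣ℚ <ℚ δ) → ∣ total (edges Γ) f -ℚ total (edges Γ) g ∣ℚ <ℚ q) →
      (∀ e → AllPairs (λ x y → ε ≤ℚ ∣ x -ℚ y ∣ℚ) (map (λ x → seq x m) (toList (L e)))) →
      (∀ {n} → m ≤ n → ∀ {e x} → x ∈ toList (L e) → ∣ seq x m -ℚ seq x n ∣ℚ <ℚ δ) →
      ∃[ w ] ((∀ e → w e ∈ᵥ L e) × ProperColouring Γ (vertexSum Γ w))
    select ε η h q δ m 0≤η refl 0<h refl refl 0<δ close sep near =
      W , (λ e → ∈-toList⁻ (W∈ e)) , λ {x} {y} xy → h , m , 0<h , λ {n} m≤n →
        difference-stable {vs x m} {vs y m} {vs x n} {vs y n} refl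
          (subst (η ≤ℚ_) (cong ∣_∣ℚ (trans (D-weight η 0≤η x y w)
            (cong₂ _-ℚ_ (approximates x) (approximates y)))) (gap (proper xy)))
          (drift x m≤n) (drift y m≤n)
      where
      sorted : ∀ e → ∃[ zs ] (zs ↭ map (λ x → seq x m) (toList (L e)) × AllPairs (λ x y → y +ℚ ε ≤ℚ x) zs)
      sorted e = sort-decreasing (sep e)

      A : Edge Γ → ℕ → ℚ
      A e = nth (proj₁ (sorted e))

      length-sorted : ∀ e → k ≡ length (proj₁ (sorted e))
      length-sorted e = sym (trans (↭-length (proj₁ (proj₂ (sorted e))))
        (trans (Listₚ.length-map (λ x → seq x m) (toList (L e))) (Vecₚ.length-toList (L e))))

      decreasing : ∀ e → Decreasing {Γ = Γ} η 0≤η k (A e)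
      decreasing e {j = j} i<j j<k =
        nth-pairs (proj₂ (proj₂ (sorted e))) i<j (subst (j <_) (length-sorted e) j<k)

      coloured : Coloured n d 0≤η 3≤n G A decreasing ⊤
      coloured = colour n d 0≤η 3≤n G A decreasing degenerate _ ⊤ ℕₚ.≤-refl

      w : Edge Γ → ℚ
      w = proj₁ coloured

      proper : ∀ {x y} → Adj Γ x y → Far η 0≤η w x y
      proper {x} {y} = proj₂ (proj₂ coloured) {x} {y} ∈⊤ ∈⊤

      -- Each chosen rational is the term at index `m` of a real in the list, and that real becomes
      -- the weight.
      lifted : ∀ e → ∃[ x ] (x ∈ toList (L e) × w e ≡ seq x m)
      lifted e =
        let i , i<k , eq = proj₁ (proj₂ coloured) e
        in ∈-map⁻ (λ x → seq x m) (∈-resp-↭ (proj₁ (proj₂ (sorted e)))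
             (subst (_∈ proj₁ (sorted e)) (sym eq)
               (nth-∈ (proj₁ (sorted e)) (subst (i <_) (length-sorted e) i<k))))

      W : Edge Γ → ℝ
      W e = proj₁ (lifted e)

      W∈ : ∀ e → W e ∈ toList (L e)
      W∈ e = proj₁ (proj₂ (lifted e))

      vs : Fin (N * n) → ℕ → ℚ
      vs x = seq (vertexSum Γ W x)

      approximates : ∀ x → weight η 0≤η w x ≡ vs x m
      approximates x = trans (weight-cong η 0≤η {w} {λ e → seq (W e) m} x (λ e → proj₂ (proj₂ (lifted e))))
        (sym (seq-sum-filter (x ∈ₑ?_) W m (edges Γ)))

      drift : ∀ x {n} → m ≤ n → ∣ vs x m -ℚ vs x n ∣ℚ <ℚ q
      drift x {n} m≤n = subst₂ (λ s t → ∣ s -ℚ t ∣ℚ <ℚ q)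
        (sym (seq-sum-filter (x ∈ₑ?_) W m (edges Γ))) (sym (seq-sum-filter (x ∈ₑ?_) W n (edges Γ)))
        (close (share η 0≤η x (λ e → seq (W e) m)) (share η 0≤η x (λ e → seq (W e) n))
          λ e → if-near (does (x ∈ₑ? e)) 0<δ (near m≤n (W∈ e)))

-- If no least value existed, a choosable `j < k` would be refuted by induction on the bound `b`;
-- hence `k` itself would be minimal. The argument by contradiction is constructive because the
-- order on `ℕ` is decidable.
least : ∀ {M} (Γ : Graph M) b k → k ≤ b → 1 ≤ k → SumChoosable Γ k →
        ¬ ¬ (∃[ j ] (IsChΣᵉ Γ j × j ≤ k))
least Γ zero    _ z≤n ()
least Γ (suc b) k k≤b 1≤k choosable none = none (k , (1≤k , choosable , minimal) , ℕₚ.≤-refl)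
  where
  minimal : ∀ j → 1 ≤ j → SumChoosable Γ j → k ≤ j
  minimal j 1≤j choosable′ = ℕₚ.≮⇒≥ λ j<k →
    least Γ b j (ℕₚ.≤-pred (ℕₚ.≤-trans j<k k≤b)) 1≤j choosable′
      λ { (i , i-least , i≤j) → none (i , i-least , ℕₚ.≤-trans i≤j (ℕₚ.<⇒≤ j<k)) }

corollary5p3 : ∀ (n d N : ℕ) → 3 ≤ n → (G : Graph N) → Degenerate d G →
               chΣᵉ (G □ complete n) ≤ (n * d + 3)
corollary5p3 n d N 3≤n G degenerate =
  (k , 1≤k , ℕₚ.≤-refl , choosable) , least (G □ complete n) k k ℕₚ.≤-refl 1≤k choosable
  where
  k = n * d + 3
  1≤k = ℕₚ.≤-trans (s≤s z≤n) (ℕₚ.m≤n+m 3 (n * d))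
  choosable = product-choosable n d 3≤n G degenerate
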